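{- Let $k\ge t\ge 2$ and $\lambda\ge 1$ be integers. Then the class $\overrightarrow{P\mathcal D}_{kt\lambda}$ of all finite linearly ordered partial $(k,t,\lambda)$-designs (with embeddings as described in the context) is a Ramsey class: for every $\mathbf A,\mathbf B\in\overrightarrow{P\mathcal D}_{kt\lambda}$ and every positive integer $r$ there exists $\mathbf C\in\overrightarrow{P\mathcal D}_{kt\lambda}$ such that for every partition of $\binom{\mathbf C}{\mathbf A}$ into $r$ classes there is $\widetilde{\mathbf B}\in\binom{\mathbf C}{\mathbf B}$ with $\binom{\widetilde{\mathbf B}}{\mathbf A}$ contained in a single class.
   Context: A partial $(k,t,\lambda)$-design is a finite hypergraph $(X,R)$ with $R\subseteq\binom{X}{k}$ such that every $t$-element subset of $X$ is contained in at most $\lambda$ members (blocks) of $R$. For a $t$-subset $T$, its neighbourhood $N(T)$ is the union of all blocks containing $T$; it has size $0$ or between $k$ and $K=(k-t)\lambda+t$. In the paper such a design is encoded as a structure $\mathbf A=(A,R_{\mathbf A},(F^\ell_{\mathbf A})_{k\le\ell\le K})$ where $R_{\mathbf A}$ is the set of ordered $k$-tuples of distinct vertices whose underlying set is a block, and $F^\ell_{\mathbf A}$ is a partial function defined exactly on those $t$-tuples $(v_1,\dots,v_t)$ with $|N(\{v_1,\dots,v_t\})|=\ell$, with value the (unordered) set $N(\{v_1,\dots,v_t\})$. $\overrightarrow{P\mathcal D}_{kt\lambda}$ consists of these structures expanded by an arbitrary linear order $\le$ of the vertex set. An embedding $f:\mathbf A\to\mathbf B$ is an injective order-preserving map $f:A\to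 B$ such that (i) a $k$-subset $M\subseteq A$ is a block of $\mathbf A$ iff $f(M)$ is a block of $\mathbf B$, and (ii) for each $\ell$ and $t$-tuple $\vec x$ of $A$, $\vec x\in\mathrm{dom}(F^\ell_{\mathbf A})$ iff $f(\vec x)\in\mathrm{dom}(F^\ell_{\mathbf B})$, and then $f(F^\ell_{\mathbf A}(\vec x))=F^\ell_{\mathbf B}(f(\vec x))$. Equivalently, (ii) may be replaced by: every block of $\mathbf B$ that is not the image of a block of $\mathbf A$ meets $f(A)$ in at most $t-1$ elements. $\binom{\mathbf B}{\mathbf A}$ denotes the set of all images of embeddings $\mathbf A\to\mathbf B$ (copies of $\mathbf A$ in $\mathbf B$). -}

module Defs where

open import Data.Nat using (ℕ; suc)
open import Data.Bool using (Bool; T)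
open import Data.Fin using (Fin; _<_; _≟_)
open import Data.Fin.Subset using (Subset; _∈_; _⊆_; ∣_∣; ⊤)
open import Data.Fin.Subset.Properties using (_∈?_)
open import Data.Fin.Properties using (any?)
open import Data.Empty using (⊥)
open import Data.Product using (Σ; ∃; _×_)
open import Data.Vec using (tabulate)
open import Function using (_∘_; _⇔_)
open import Function.Definitions using (Injective)
open import Relation.Binary.PropositionalEquality using (_≡_)
open import Relation.Nullary.Decidable using (⌊_⌋; _×-dec_)

image : ∀ {a b} → (Fin a → Fin b) → Subset a → Subset b
image {a} f S = tabulate (λ y → ⌊ any? (λ x → (x ∈? S) ×-dec (f x ≟ y)) ⌋)

-- A finite linearly ordered partial (k,t,λ)-design.  Vertex set is Fin n,
-- linearly ordered by the natural order of Fin n.  Blocks are given by a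
-- Boolean predicate on subsets of the vertex set.
record PDesign (k t μ : ℕ) : Set where
  field
    n        : ℕ
    isBlock  : Subset n → Bool
    blockSize : ∀ M → T (isBlock M) → ∣ M ∣ ≡ k
    partialDesign : ∀ (S : Subset n) → ∣ S ∣ ≡ t →
      ∀ (Ms : Fin (suc μ) → Subset n) → Injective _≡_ _≡_ Ms →
      (∀ i → T (isBlock (Ms i)) × S ⊆ Ms i) → ⊥

open PDesign public

Block : ∀ {k t μ} (D : PDesign k t μ) → Subset (n D) → Set
Block D M = T (isBlock D M)

InNbhd : ∀ {k t μ} (D : PDesign k t μ) → Subset (n D) → Fin (n D) → Set
InNbhd D S v = ∃ λ M → Block D M × S ⊆ M × v ∈ M

record Embedding {k t μ} (A B : PDesign k t μ) : Set where
  field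
    fun : Fin (n A) → Fin (n B)
    mono : ∀ x y → x < y → fun x < fun y
    blocks : ∀ (M : Subset (n A)) → ∣ M ∣ ≡ k →
      Block A M ⇔ Block B (image fun M)
    -- (ii) for every t-subset S of A, N_B(f(S)) = f(N_A(S))
    --      (this is exactly the F^ℓ condition: domains and values agree)
    nbhd : ∀ (S : Subset (n A)) → ∣ S ∣ ≡ t → ∀ (y : Fin (n B)) →
      InNbhd B (image fun S) y ⇔ (∃ λ x → fun x ≡ y × InNbhd A S x)

open Embedding public

copy : ∀ {a b} → (Fin a → Fin b) → Subset b
copy f = image f ⊤

{-# OPTIONS --safe #-}

-- Blocks are kept as increasing k-tuples, and a map is strong when it is injective, sends blocks to
-- blocks, and every block meeting its image in t vertices is the image of a block. Nothing in the
-- construction mentions λ: if every block of C lies in a strong copy of B, then C inherits the bound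
-- from B.
--
-- C arises by the Nešetřil–Rödl partite construction over a Ramsey number N: start from disjoint copies
-- of B over all maps β : B → [N] and treat the images e of A in [N] one after the other. For one e, apply
-- Hales–Jewett to the copies of A over e and glue a copy of the current picture P along every
-- combinatorial line. Two lines with the same moving coordinates may share t vertices of a block that is
-- not contained in the part over e, so P need not be strong in this power. The copies of A given by the
-- words, however, satisfy the strongness condition on t vertices. Hence a second partite construction, over
-- the power and its words and starting from disjoint copies of P for all lines, only glues along parts
-- with the property that a block meeting one in t vertices lies inside it; for such parts lines are strong.
module Submission where

open import Defs
open import Data.Nat using (ℕ; zero; suc; _+_; _*_; _^_; _≤_; _<_; z≤n; s≤s; s≤s⁻¹; _≤?_)
import Data.Nat.Properties as ℕ
open import Data.Bool using (true; false)
import Data.Bool.Properties as Bool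
open import Data.Fin using (Fin; zero; suc; _≟_; toℕ; inject₁; inject≤; cast; combine; _↑ˡ_; _↑ʳ_; funToFin; finToFun)
import Data.Fin as Fin
import Data.Fin.Properties as Fin
open import Data.Fin.Properties using (any?; all?; pigeonhole; finToFun-funToFin; cast-involutive)
open import Data.Fin.Subset using (Subset; _∈_; _∉_; _⊆_; ∣_∣; ⊤; ⊥; ⁅_⁆; _∪_; inside; outside)
open import Data.Fin.Subset.Properties using (_∈?_; nonempty?; Empty-unique; ∣⊥∣≡0; ∣⊤∣≡n; ∈⊤; ⊥⊆; s⊆s;
  ⊆-reflexive; ⊆-antisym; ∪-identityˡ; x∈⁅x⁆; x∈⁅y⁆⇒x≡y; p⊆p∪q; q⊆p∪q; x∈p∪q⁻)
open import Data.List using (List; []; _∷_; length; filter; concatMap; cartesianProduct; cartesianProductWith; allFin)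
import Data.List as List
import Data.List.Properties as List
import Data.List.Membership.Propositional as Mem
open import Data.List.Membership.Propositional.Properties using (∈-map⁺; ∈-map⁻; ∈-++⁺ˡ; ∈-++⁺ʳ; ∈-allFin; ∈-concatMap⁺;
  ∈-filter⁺; ∈-filter⁻; ∈-lookup; ∈-cartesianProduct⁺; ∈-cartesianProductWith⁺; ∈-cartesianProductWith⁻)
open import Data.List.Relation.Binary.Sublist.Propositional as Sub using ([]; _∷_; _∷ʳ_; minimum; ⊆-refl; ⊆-trans)
open import Data.List.Relation.Binary.Sublist.Propositional.Properties using (map⁺; filter-⊆; All-resp-⊆)
open import Data.List.Relation.Unary.All as All using (All; []; _∷_)
open import Data.List.Relation.Unary.All.Properties using (all-filter)
open import Data.List.Relation.Unary.AllPairs using (AllPairs; []; _∷_)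
import Data.List.Relation.Unary.AllPairs.Properties as AllPairs
open import Data.List.Relation.Unary.Any as Any using (here; there; index)
open import Data.List.Relation.Unary.Any.Properties using (lookup-index)
open import Data.Maybe using (Maybe; just; nothing; fromMaybe)
import Data.Maybe as Maybe
open import Data.Vec using (Vec; []; _∷_; lookup; tabulate; _++_; here; there)
import Data.Vec as Vec
open import Data.Vec.Properties using (map-++; map-∘; map-id; lookup-map; lookup-++ˡ; lookup-++ʳ;
  lookup∘tabulate; tabulate-cong; []=⇒lookup; lookup⇒[]=; ≡-dec)
open import Data.Product using (Σ; ∃; _×_; _,_; proj₁; proj₂)
open import Data.Sum using (_⊎_; inj₁; inj₂)
open import Data.Sum.Properties using (inj₁-injective)
open import Data.Empty using (⊥-elim)
import Data.Empty as Empty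
open import Data.Unit using (tt)
import Data.Unit as Unit
open import Function using (_∘_; id; mk⇔; Equivalence)
open import Function.Definitions using (Injective)
open import Relation.Nullary using (Dec; yes; no; ¬_; ¬?; Irrelevant)
open import Relation.Nullary.Decidable using (⌊_⌋; map′; _×-dec_; _→-dec_; T?; toWitness; fromWitness; isYes≗does; dec-true)
open import Relation.Unary using (Decidable)
open import Relation.Binary.Definitions using (DecidableEquality; tri<; tri≈; tri>)
open import Relation.Binary.PropositionalEquality using (_≡_; refl; sym; trans; cong; subst; subst₂; _≗_; module ≡-Reasoning)
open import Axiom.UniquenessOfIdentityProofs.WithK using (uip)

-- Finite types given by complete lists

record Listed (X : Set) : Set where
  constructor listed
  field
    elems    : List X
    complete : ∀ x → x Mem.∈ elems

  size : ℕ
  size = length elems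

  code : X → Fin size
  code x = index (complete x)

  decode : Fin size → X
  decode = List.lookup elems

  decode-code : ∀ x → decode (code x) ≡ x
  decode-code x = sym (lookup-index (complete x))

  -- Repetitions in `elems` do no harm: `code` picks one position for each element, and reading the
  -- list there returns the element.
  code-injective : Injective _≡_ _≡_ code
  code-injective {x} {y} p = trans (sym (decode-code x)) (trans (cong decode p) (decode-code y))

  infix 4 _≟ᶜ_
  _≟ᶜ_ : DecidableEquality X
  x ≟ᶜ y = map′ code-injective (cong code) (code x ≟ code y)

  exists? : ∀ {P : X → Set} → Decidable P → Dec (∃ P)
  exists? P? = map′ (λ p → let x , _ , q = Mem.find p in x , q) (λ (x , p) → Mem.lose (complete x) p) (Any.any? P? elems)

  forall? : ∀ {P : X → Set} → Decidable P → Dec (∀ x → P x)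
  forall? P? = map′ (λ all x → All.lookup all (complete x)) (λ p → All.tabulate (λ {x} _ → p x)) (All.all? P? elems)

open Listed

abstract

  listedFin : ∀ n → Listed (Fin n)
  listedFin n = listed (allFin n) ∈-allFin

  listed× : ∀ {X Y} → Listed X → Listed Y → Listed (X × Y)
  listed× (listed xs cx) (listed ys cy) = listed (cartesianProduct xs ys) (λ (x , y) → ∈-cartesianProduct⁺ (cx x) (cy y))

  listed⊎ : ∀ {X Y} → Listed X → Listed Y → Listed (X ⊎ Y)
  listed⊎ (listed xs cx) (listed ys cy) = listed (List.map inj₁ xs List.++ List.map inj₂ ys) λ where
    (inj₁ x) → ∈-++⁺ˡ (∈-map⁺ inj₁ (cx x))
    (inj₂ y) → ∈-++⁺ʳ (List.map inj₁ xs) (∈-map⁺ inj₂ (cy y))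

  listedMaybe : ∀ {X} → Listed X → Listed (Maybe X)
  listedMaybe (listed xs cx) = listed (nothing ∷ List.map just xs) λ where
    nothing  → here refl
    (just x) → there (∈-map⁺ just (cx x))

  listedMap : ∀ {X Y} (f : X → Y) (g : Y → X) → (∀ y → f (g y) ≡ y) → Listed X → Listed Y
  listedMap f g fg (listed xs cx) = listed (List.map f xs) λ y →
    subst (Mem._∈ List.map f xs) (fg y) (∈-map⁺ f (cx (g y)))

  listedVec : ∀ {X} → Listed X → ∀ n → Listed (Vec X n)
  listedVec lx zero    = listed ([] ∷ []) (λ { [] → here refl })
  listedVec lx (suc n) = listedMap (λ (x , xs) → x ∷ xs) (λ { (x ∷ xs) → x , xs }) (λ { (x ∷ xs) → refl })
    (listed× lx (listedVec lx n))

  -- The proof found by `P?` need not be the one in the given pair; irrelevance identifies the two.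
  listedΣ : ∀ {X} {P : X → Set} → Decidable P → (∀ x → Irrelevant (P x)) → Listed X → Listed (Σ X P)
  listedΣ {X} {P} P? irr (listed xs cx) = listed (concatMap pick xs) λ (x , p) →
    ∈-concatMap⁺ pick (Mem.lose (cx x) (∈-pick x p))
    where
    pick : X → List (Σ X P)
    pick x with P? x
    ... | yes p = (x , p) ∷ []
    ... | no _  = []

    ∈-pick : ∀ x p → (x , p) Mem.∈ pick x
    ∈-pick x p with P? x
    ... | yes q = here (cong (x ,_) (irr x p q))
    ... | no ¬p = ⊥-elim (¬p p)

-- Hales–Jewett: nothing marks a moving coordinate

infix 8 _⟨_⟩
_⟨_⟩ : ∀ {Q : Set} {m} → Vec (Maybe Q) m → Q → Vec Q m
L ⟨ c ⟩ = Vec.map (fromMaybe c) L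

Moving : ∀ {Q : Set} {m} → Vec (Maybe Q) m → Set
Moving L = ∃ λ i → lookup L i ≡ nothing

constant-⟨⟩ : ∀ {Q : Set} {m} (u : Vec Q m) c → Vec.map just u ⟨ c ⟩ ≡ u
constant-⟨⟩ u c = trans (sym (map-∘ (fromMaybe c) just u)) (map-id u)

++-⟨⟩ : ∀ {Q : Set} {m n} (K : Vec (Maybe Q) m) (L : Vec (Maybe Q) n) c → (K ++ L) ⟨ c ⟩ ≡ K ⟨ c ⟩ ++ L ⟨ c ⟩
++-⟨⟩ K L c = map-++ (fromMaybe c) K L

movingˡ : ∀ {Q : Set} {m n} (K : Vec (Maybe Q) m) (L : Vec (Maybe Q) n) → Moving K → Moving (K ++ L)
movingˡ {n = n} K L (i , p) = i ↑ˡ n , trans (lookup-++ˡ K L i) p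

movingʳ : ∀ {Q : Set} {m n} (K : Vec (Maybe Q) m) (L : Vec (Maybe Q) n) → Moving L → Moving (K ++ L)
movingʳ {m = m} K L (i , p) = m ↑ʳ i , trans (lookup-++ʳ K L i) p

lift : ∀ {q m} → Vec (Maybe (Fin q)) m → Vec (Maybe (Fin (suc q))) m
lift = Vec.map (Maybe.map suc)

lift-⟨suc⟩ : ∀ {q m} (L : Vec (Maybe (Fin q)) m) c → lift L ⟨ suc c ⟩ ≡ Vec.map suc (L ⟨ c ⟩)
lift-⟨suc⟩ []            c = refl
lift-⟨suc⟩ (nothing ∷ L) c = cong (suc c ∷_) (lift-⟨suc⟩ L c)
lift-⟨suc⟩ (just d ∷ L)  c = cong (suc d ∷_) (lift-⟨suc⟩ L c)

lift-moving : ∀ {q m} (L : Vec (Maybe (Fin q)) m) → Moving L → Moving (lift L)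
lift-moving L (i , p) = i , trans (lookup-map i (Maybe.map suc) L) (cong (Maybe.map suc) p)

MonoLine : ∀ {q m r} → (Vec (Fin q) m → Fin r) → Set
MonoLine {q} {m} χ = ∃ λ (L : Vec (Maybe (Fin q)) m) → Moving L × (∀ c d → χ (L ⟨ c ⟩) ≡ χ (L ⟨ d ⟩))

-- Colour focusing: the lines agree at the letter zero and have distinct colours off it.
record Focused {q m r} (χ : Vec (Fin (suc q)) m → Fin r) (s : ℕ) : Set where
  field
    focus     : Vec (Fin (suc q)) m
    line      : Fin s → Vec (Maybe (Fin (suc q))) m
    moving    : ∀ i → Moving (line i)
    colour    : Fin s → Fin r
    distinct  : Injective _≡_ _≡_ colour
    at-focus  : ∀ i → line i ⟨ zero ⟩ ≡ focus
    off-focus : ∀ i c → χ (line i ⟨ suc c ⟩) ≡ colour i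

HalesJewett : ℕ → Set
HalesJewett q = ∀ r → ∃ λ m → ∀ (χ : Vec (Fin q) m → Fin r) → MonoLine χ

-- Freezing the first coordinates at `u` turns a line in the remaining ones into a line in all of
-- them.
prefixMono : ∀ {q m n r} (χ : Vec (Fin q) (m + n) → Fin r) (u : Vec (Fin q) m) →
  MonoLine (λ v → χ (u ++ v)) → MonoLine χ
prefixMono χ u (L , mv , mono) = Vec.map just u ++ L , movingʳ (Vec.map just u) L mv , λ c d →
  trans (cong χ (eq c)) (trans (mono c d) (sym (cong χ (eq d))))
  where
  eq : ∀ c → (Vec.map just u ++ L) ⟨ c ⟩ ≡ u ++ L ⟨ c ⟩
  eq c = trans (++-⟨⟩ (Vec.map just u) L c) (cong (_++ L ⟨ c ⟩) (constant-⟨⟩ u c))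

module _ {q r : ℕ} (hj : HalesJewett (suc q)) where

  -- Induction on the number of focused lines. Hales-Jewett for one letter fewer is used on a long
  -- prefix, with colourings of the remaining coordinates as colours; it yields a prefix line whose
  -- nonzero letters the colour cannot tell apart. The induction hypothesis is then applied behind a
  -- fixed prefix `u₀` on that line.
  focusing : ∀ s → ∃ λ m → ∀ (χ : Vec (Fin (suc (suc q))) m → Fin r) → MonoLine χ ⊎ Focused χ s
  focusing zero = 0 , λ χ → inj₂ record
    { focus = [] ; line = λ () ; moving = λ () ; colour = λ () ; distinct = λ {i} → ⊥-elim (Fin.¬Fin0 i)
    ; at-focus = λ () ; off-focus = λ () }
  focusing (suc s) with focusing s
  ... | m , ih = proj₁ (hj R) + m , step
    where
    words : Listed (Vec (Fin (suc (suc q))) m)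
    words = listedVec (listedFin _) m

    R : ℕ
    -- A prefix without the letter zero is coloured by the whole function that it induces on the
    -- listed suffixes; this is the number of such functions.
    R = r ^ size words

    N : ℕ
    N = proj₁ (hj R)

    step : ∀ χ → MonoLine χ ⊎ Focused χ (suc s)
    step χ with proj₂ (hj R) (λ u → funToFin (λ x → χ (Vec.map suc u ++ decode words x)))
    ... | L₀ , mv₀ , mono₀ = cases (ih ψ)
      where
      u₀ : Vec (Fin (suc (suc q))) N
      u₀ = Vec.map suc (L₀ ⟨ zero ⟩)

      ψ : Vec (Fin (suc (suc q))) m → Fin r
      ψ v = χ (u₀ ++ v)

      -- The prefixes on `L₀` have equal codes; evaluating the coded function at the position of `v`
      -- gives the equality.
      ψ-indep : ∀ c v → χ (lift L₀ ⟨ suc c ⟩ ++ v) ≡ ψ v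
      ψ-indep c v = begin
        χ (lift L₀ ⟨ suc c ⟩ ++ v)         ≡⟨ cong (λ u → χ (u ++ v)) (lift-⟨suc⟩ L₀ c) ⟩
        χ (Vec.map suc (L₀ ⟨ c ⟩) ++ v)         ≡⟨ cong (λ w → χ (Vec.map suc (L₀ ⟨ c ⟩) ++ w)) (decode-code words v) ⟨
        χ (Vec.map suc (L₀ ⟨ c ⟩) ++ decode words (code words v))
          ≡⟨ finToFun-funToFin (λ x → χ (Vec.map suc (L₀ ⟨ c ⟩) ++ decode words x)) (code words v) ⟨
        finToFun (funToFin (λ x → χ (Vec.map suc (L₀ ⟨ c ⟩) ++ decode words x))) (code words v)
          ≡⟨ cong (λ f → finToFun f (code words v)) (mono₀ c zero) ⟩
        finToFun (funToFin (λ x → χ (u₀ ++ decode words x))) (code words v)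
          ≡⟨ finToFun-funToFin (λ x → χ (u₀ ++ decode words x)) (code words v) ⟩
        χ (u₀ ++ decode words (code words v)) ≡⟨ cong (λ w → χ (u₀ ++ w)) (decode-code words v) ⟩
        ψ v ∎
        where open ≡-Reasoning

      cases : MonoLine ψ ⊎ Focused ψ s → MonoLine χ ⊎ Focused χ (suc s)
      cases (inj₁ ml) = inj₁ (prefixMono χ u₀ ml)
      cases (inj₂ F) = split (any? (λ i → colour i ≟ ψ focus))
        where
        open Focused F

        split : Dec (∃ λ i → colour i ≡ ψ focus) → MonoLine χ ⊎ Focused χ (suc s)
        -- Off the focus, line `i` already has the colour of the focus, so it is monochromatic with
        -- the focus included.
        split (yes (i , p)) = inj₁ (prefixMono χ u₀ (line i , moving i , λ c d → trans (const c) (sym (const d))))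
          where
          const : ∀ c → ψ (line i ⟨ c ⟩) ≡ ψ focus
          const zero    = cong ψ (at-focus i)
          const (suc c) = trans (off-focus i c) p
        -- The colour of the focus is new. The old lines get the moving prefix `lift L₀`; the added
        -- line moves in this prefix only and has, off the letter zero, the colour of the old focus.
        split (no ¬p) = inj₂ record
          { focus = lift L₀ ⟨ zero ⟩ ++ focus
          ; line = line′
          ; moving = λ { zero → movingˡ (lift L₀) _ (lift-moving L₀ mv₀) ; (suc i) → movingˡ (lift L₀) _ (lift-moving L₀ mv₀) }
          ; colour = colour′
          ; distinct = distinct′
          ; at-focus = λ where
              zero    → trans (++-⟨⟩ (lift L₀) _ zero) (cong (lift L₀ ⟨ zero ⟩ ++_) (constant-⟨⟩ focus zero))
              (suc i) → trans (++-⟨⟩ (lift L₀) _ zero) (cong (lift L₀ ⟨ zero ⟩ ++_) (at-focus i))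
          ; off-focus = λ where
              zero c    → trans (cong χ (trans (++-⟨⟩ (lift L₀) _ (suc c)) (cong (lift L₀ ⟨ suc c ⟩ ++_) (constant-⟨⟩ focus (suc c)))))
                          (ψ-indep c focus)
              (suc i) c → trans (cong χ (++-⟨⟩ (lift L₀) _ (suc c))) (trans (ψ-indep c _) (off-focus i c))
          }
          where
          line′ : Fin (suc s) → Vec (Maybe (Fin (suc (suc q)))) (N + m)
          line′ zero    = lift L₀ ++ Vec.map just focus
          line′ (suc i) = lift L₀ ++ line i

          colour′ : Fin (suc s) → Fin r
          colour′ zero    = ψ focus
          colour′ (suc i) = colour i

          distinct′ : Injective _≡_ _≡_ colour′
          distinct′ {zero}  {zero}  p = refl
          distinct′ {zero}  {suc j} p = ⊥-elim (¬p (j , sym p))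
          distinct′ {suc i} {zero}  p = ⊥-elim (¬p (i , p))
          distinct′ {suc i} {suc j} p = cong suc (distinct p)

abstract

  -- Induction on the alphabet. A family of `suc r` focused lines would need more than `r` distinct
  -- colours, so `focusing` must return a monochromatic line.
  halesJewett : ∀ q → HalesJewett q
  halesJewett zero          r = 1 , λ χ → nothing ∷ [] , (zero , refl) , λ ()
  halesJewett (suc zero)    r = 1 , λ χ → nothing ∷ [] , (zero , refl) , λ { zero zero → refl }
  halesJewett (suc (suc q)) r with focusing {r = r} (halesJewett (suc q)) (suc r)
  ... | m , foc = m , λ χ → finish (foc χ)
    where
    finish : ∀ {χ : Vec (Fin (suc (suc q))) m → Fin r} → MonoLine χ ⊎ Focused χ (suc r) → MonoLine χ
    finish (inj₁ ml) = ml
    finish (inj₂ F) with pigeonhole (ℕ.n<1+n r) (Focused.colour F)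
    ... | i , j , i<j , p = ⊥-elim (Fin.<⇒≢ i<j (Focused.distinct F p))

-- Finite Ramsey theorem

length-filter-¬ : ∀ {Y : Set} {P : Y → Set} (P? : Decidable P) ys →
  length (filter P? ys) + length (filter (¬? ∘ P?) ys) ≡ length ys
length-filter-¬ P? []       = refl
length-filter-¬ P? (y ∷ ys) with P? y
... | yes _ = cong suc (length-filter-¬ P? ys)
... | no _  = trans (ℕ.+-suc _ _) (cong suc (length-filter-¬ P? ys))

-- Induction on the number of colours: if fewer than `b` elements have colour zero, enough elements
-- are left for the other colours.
pigeonholeList : ∀ r b {Y : Set} (κ : Y → Fin (suc r)) ys → suc r * b ≤ length ys →
  ∃ λ c → ∃ λ zs → zs Sub.⊆ ys × b ≤ length zs × All (λ y → κ y ≡ c) zs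
pigeonholeList zero b κ ys le = zero , ys , ⊆-refl , subst (_≤ length ys) (ℕ.*-identityˡ b) le ,
  All.universal (λ y → fin1 (κ y)) ys
  where
  fin1 : ∀ (i : Fin 1) → i ≡ zero
  fin1 zero = refl
pigeonholeList (suc r) b {Y} κ ys le = cases (b ≤? length zeros)
  where
  zero? : Decidable (λ y → κ y ≡ zero)
  zero? y = κ y ≟ zero

  zeros others : List Y
  zeros  = filter zero? ys
  others = filter (¬? ∘ zero?) ys

  pred : Fin (suc (suc r)) → Fin (suc r)
  -- Default value: no member of `others` has colour zero.
  pred zero    = zero
  pred (suc i) = i

  unpred : ∀ {i c} → ¬ i ≡ zero → pred i ≡ c → i ≡ suc c
  unpred {zero}  i≢0 p = ⊥-elim (i≢0 refl)
  unpred {suc i} i≢0 p = cong suc p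

  cases : Dec (b ≤ length zeros) → ∃ λ c → ∃ λ zs → zs Sub.⊆ ys × b ≤ length zs × All (λ y → κ y ≡ c) zs
  cases (yes b≤) = zero , zeros , filter-⊆ zero? ys , b≤ , all-filter zero? ys
  cases (no b≰) with pigeonholeList r b (pred ∘ κ) others (ℕ.+-cancelˡ-≤ b _ _ (begin
      b + suc r * b                   ≤⟨ le ⟩
      length ys                       ≡⟨ length-filter-¬ zero? ys ⟨
      length zeros + length others    ≤⟨ ℕ.+-monoˡ-≤ (length others) (ℕ.<⇒≤ (ℕ.≰⇒> b≰)) ⟩
      b + length others               ∎))
    where open ℕ.≤-Reasoning
  ... | c , zs , zs⊆ , b≤ , all = suc c , zs , ⊆-trans zs⊆ (filter-⊆ _ ys) , b≤ ,
    All.zipWith (λ (p , q) → unpred p q) (All-resp-⊆ zs⊆ (all-filter (¬? ∘ zero?) ys) , all)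

Homogeneous : ∀ {X : Set} {r} → ℕ → (List X → Fin r) → Fin r → List X → Set
Homogeneous a χ c ys = ∀ {zs} → zs Sub.⊆ ys → length zs ≡ a → χ zs ≡ c

-- The colour of a sublist of `suc a` elements depends on its first element only, and each pair
-- stores this colour.
EndHomogeneous : ∀ {X : Set} {r} → ℕ → (List X → Fin r) → List (X × Fin r) → Set
EndHomogeneous a χ []             = Unit.⊤
EndHomogeneous a χ ((x , c) ∷ ps) = Homogeneous a (χ ∘ (x ∷_)) c (List.map proj₁ ps) × EndHomogeneous a χ ps

EndHomogeneous-⊆ : ∀ {X : Set} {r a} {χ : List X → Fin r} {ps qs} → qs Sub.⊆ ps →
  EndHomogeneous a χ ps → EndHomogeneous a χ qs
EndHomogeneous-⊆ []         eh       = tt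
EndHomogeneous-⊆ (p ∷ʳ τ)   (_ , eh) = EndHomogeneous-⊆ τ eh
EndHomogeneous-⊆ (refl ∷ τ) (h , eh) = (λ σ → h (⊆-trans σ (map⁺ proj₁ τ))) , EndHomogeneous-⊆ τ eh

endHomogeneous⇒homogeneous : ∀ {X : Set} {r a c} {χ : List X → Fin r} {ps} →
  EndHomogeneous a χ ps → All (λ p → proj₂ p ≡ c) ps → Homogeneous (suc a) χ c (List.map proj₁ ps)
endHomogeneous⇒homogeneous {ps = []}     eh       all         []         ()
endHomogeneous⇒homogeneous {ps = p ∷ ps} (_ , eh) (_ ∷ all)    (_ ∷ʳ σ)   len = endHomogeneous⇒homogeneous eh all σ len
endHomogeneous⇒homogeneous {ps = p ∷ ps} (h , _)  (refl ∷ _)   (refl ∷ σ) len = h σ (ℕ.suc-injective len)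

-- Induction on `a`. Of `suc r * b` end-homogeneous elements, `b` store the same colour, and these
-- form a homogeneous list.
ramsey : ∀ r a b → ∃ λ N → ∀ {X : Set} (xs : List X) → N ≤ length xs → (χ : List X → Fin (suc r)) →
  ∃ λ ys → ys Sub.⊆ xs × b ≤ length ys × ∃ λ c → Homogeneous a χ c ys

-- Greedy choice: the first element `x` is kept, the rest is thinned until `x` followed by any `a`
-- elements has a constant colour, and the search continues in what remains.
endRamsey : ∀ r a m → ∃ λ N → ∀ {X : Set} (xs : List X) → N ≤ length xs → (χ : List X → Fin (suc r)) →
  ∃ λ ps → List.map proj₁ ps Sub.⊆ xs × m ≤ length ps × EndHomogeneous a χ ps
endRamsey r a zero    = 0 , λ xs _ χ → [] , minimum xs , z≤n , tt
endRamsey r a (suc m) with endRamsey r a m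
... | N , eh with ramsey r a N
...   | N′ , ram = suc N′ , step
  where
  step : ∀ {X : Set} (xs : List X) → suc N′ ≤ length xs → (χ : List X → Fin (suc r)) →
    ∃ λ ps → List.map proj₁ ps Sub.⊆ xs × suc m ≤ length ps × EndHomogeneous a χ ps
  step (x ∷ xs) le χ with ram xs (s≤s⁻¹ le) (χ ∘ (x ∷_))
  ... | ys , ys⊆ , N≤ , c , h with eh ys N≤ χ
  ...   | ps , ps⊆ , m≤ , hom = (x , c) ∷ ps , refl ∷ ⊆-trans ps⊆ ys⊆ , s≤s m≤ , (λ σ → h (⊆-trans σ ps⊆)) , hom

ramsey r zero    b = b , λ xs b≤ χ → xs , ⊆-refl , b≤ , χ [] , λ { {[]} _ _ → refl }
ramsey r (suc a) b with endRamsey r a (suc r * b)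
... | N , eh = N , step
  where
  step : ∀ {X : Set} (xs : List X) → N ≤ length xs → (χ : List X → Fin (suc r)) →
    ∃ λ ys → ys Sub.⊆ xs × b ≤ length ys × ∃ λ c → Homogeneous (suc a) χ c ys
  step xs N≤ χ with eh xs N≤ χ
  ... | ps , ps⊆ , m≤ , hom with pigeonholeList r b proj₂ ps m≤
  ...   | c , qs , qs⊆ , b≤ , all = List.map proj₁ qs , ⊆-trans (map⁺ proj₁ qs⊆) ps⊆ ,
    subst (b ≤_) (sym (List.length-map proj₁ qs)) b≤ , c , endHomogeneous⇒homogeneous (EndHomogeneous-⊆ qs⊆ hom) all

-- Strictly monotone maps and Ramsey's theorem for them

StrictMono : ∀ {a b} → (Fin a → Fin b) → Set
StrictMono f = ∀ x y → x Fin.< y → f x Fin.< f y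

strictMono-injective : ∀ {a b} {f : Fin a → Fin b} → StrictMono f → Injective _≡_ _≡_ f
strictMono-injective mono {x} {y} p with Fin.<-cmp x y
... | tri< x<y _ _ = ⊥-elim (Fin.<⇒≢ (mono x y x<y) p)
... | tri≈ _ q _   = q
... | tri> _ _ y<x = ⊥-elim (Fin.<⇒≢ (mono y x y<x) (sym p))

strictMono-cancel-< : ∀ {a b} {f : Fin a → Fin b} → StrictMono f → ∀ {x y} → f x Fin.< f y → x Fin.< y
strictMono-cancel-< {f = f} mono {x} {y} lt with Fin.<-cmp x y
... | tri< x<y _ _  = x<y
... | tri≈ _ refl _ = ⊥-elim (Fin.<-irrefl refl lt)
... | tri> _ _ y<x  = ⊥-elim (Fin.<-asym lt (mono y x y<x))

strictMono-≤ : ∀ {a b} {f : Fin a → Fin b} → StrictMono f → ∀ {x y} → x Fin.≤ y → f x Fin.≤ f y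
strictMono-≤ {f = f} mono {x} {y} le with Fin.<-cmp x y
... | tri< x<y _ _  = ℕ.<⇒≤ (mono x y x<y)
... | tri≈ _ refl _ = ℕ.≤-refl
... | tri> _ _ y<x  = ⊥-elim (ℕ.<⇒≱ y<x le)

strictMono-inflationary : ∀ {a b} {f : Fin a → Fin b} → StrictMono f → ∀ x → toℕ x ≤ toℕ (f x)
strictMono-inflationary {f = f} mono zero    = z≤n
strictMono-inflationary {f = f} mono (suc x) = ℕ.≤-trans
  (s≤s (strictMono-inflationary {f = f ∘ inject₁} (λ y z y<z → mono _ _
    (subst₂ _<_ (sym (Fin.toℕ-inject₁ y)) (sym (Fin.toℕ-inject₁ z)) y<z)) x))
  (mono (inject₁ x) (suc x) (s≤s (ℕ.≤-reflexive (Fin.toℕ-inject₁ x))))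

-- `f` factors as `g ∘ σ` with `σ` strictly monotone, and such a `σ` never goes below the identity.
strictMono-≤-pointwise : ∀ {a b} {f g : Fin a → Fin b} → StrictMono f → StrictMono g →
  (∀ x → ∃ λ y → g y ≡ f x) → ∀ x → g x Fin.≤ f x
strictMono-≤-pointwise {a} {f = f} {g} mf mg sub x = subst (g x Fin.≤_) (proj₂ (sub x))
  (strictMono-≤ mg (strictMono-inflationary {f = σ} mσ x))
  where
  σ : Fin a → Fin a
  σ x = proj₁ (sub x)

  mσ : StrictMono σ
  mσ x y x<y = strictMono-cancel-< mg (subst₂ Fin._<_ (sym (proj₂ (sub x))) (sym (proj₂ (sub y))) (mf x y x<y))

-- Translates increasing index maps into sublists. The head `y` is kept or dropped according to
-- whether the first index is zero; the indices still to be treated are positive and can be lowered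
-- by one.
lookup-tabulate-⊆ : ∀ {X : Set} {a} (ys : List X) (f : Fin a → Fin (length ys)) → StrictMono f →
  List.tabulate (List.lookup ys ∘ f) Sub.⊆ ys
lookup-tabulate-⊆ {a = zero}  ys       f mono = minimum ys
lookup-tabulate-⊆ {a = suc a} []       f mono with f zero
... | ()
lookup-tabulate-⊆ {a = suc a} (y ∷ ys) f mono = cases (f zero) refl
  where
  pred : ∀ j → 0 < toℕ j → ∃ λ i → j ≡ suc i
  pred (suc i) _ = i , refl

  shifted : ∀ {c} (g : Fin c → Fin (suc (length ys))) → StrictMono g → (∀ x → 0 < toℕ (g x)) →
    List.tabulate (List.lookup (y ∷ ys) ∘ g) Sub.⊆ ys
  shifted g mg pos = subst (Sub._⊆ ys) (List.tabulate-cong λ x →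
      cong (List.lookup (y ∷ ys)) (sym (proj₂ (pred (g x) (pos x)))))
    (lookup-tabulate-⊆ ys (λ x → proj₁ (pred (g x) (pos x))) λ x z x<z →
      s≤s⁻¹ (subst₂ Fin._<_ (proj₂ (pred (g x) (pos x))) (proj₂ (pred (g z) (pos z))) (mg x z x<z)))

  cases : ∀ j → f zero ≡ j → List.tabulate (List.lookup (y ∷ ys) ∘ f) Sub.⊆ y ∷ ys
  cases zero p = cong (List.lookup (y ∷ ys)) p ∷ shifted (f ∘ suc) (λ x z x<z → mono _ _ (s≤s x<z))
    (λ x → subst (λ j → toℕ j < toℕ (f (suc x))) p (mono zero (suc x) (s≤s z≤n)))
  cases (suc j) p = y ∷ʳ shifted f mono (λ x → ℕ.<-≤-trans
    (subst (λ j → 0 < toℕ j) (sym p) (s≤s z≤n)) (strictMono-≤ mono {zero} {x} z≤n))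

AllPairs-resp-⊆ : ∀ {X : Set} {R : X → X → Set} {xs ys} → xs Sub.⊆ ys → AllPairs R ys → AllPairs R xs
AllPairs-resp-⊆ []         []         = []
AllPairs-resp-⊆ (_ ∷ʳ τ)   (_ ∷ rs)   = AllPairs-resp-⊆ τ rs
AllPairs-resp-⊆ (refl ∷ τ) (all ∷ rs) = All-resp-⊆ τ all ∷ AllPairs-resp-⊆ τ rs

AllPairs-lookup : ∀ {X : Set} {R : X → X → Set} {xs} → AllPairs R xs → ∀ i j → i Fin.< j →
  R (List.lookup xs i) (List.lookup xs j)
AllPairs-lookup {xs = x ∷ xs} (all ∷ rs) zero    (suc j) lt = All.lookup all (∈-lookup j)
AllPairs-lookup               (_ ∷ rs)   (suc i) (suc j) lt = AllPairs-lookup rs i j (s≤s⁻¹ lt)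

-- The colour is only attained at some e ≗ β ∘ ε because κ need not respect pointwise equality.
MonoSubset : ∀ {a N r} → ℕ → ((Fin a → Fin N) → Fin r) → Set
MonoSubset {a} {N} b κ = ∃ λ (β : Fin b → Fin N) → StrictMono β × ∃ λ c →
  ∀ (ε : Fin a → Fin b) → StrictMono ε → ∃ λ e → e ≗ β ∘ ε × κ e ≡ c

RamseyNumber : ℕ → ℕ → ℕ → ℕ → Set
RamseyNumber r a b N = ∀ (κ : (Fin a → Fin N) → Fin r) → MonoSubset b κ

ramseyNumber : ∀ r a b → ∃ (RamseyNumber (suc r) a b)
ramseyNumber r a b with ramsey r a b
... | N , ram = N , find
  where
  find : RamseyNumber (suc r) a b N
  find κ = β , β-mono , proj₁ (proj₂ (proj₂ (proj₂ result))) , λ ε ε-mono →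
      toFun (List.tabulate (β ∘ ε)) (List.length-tabulate (β ∘ ε)) ,
      List.lookup-tabulate (β ∘ ε) ,
      trans (sym (χ-toFun (List.tabulate (β ∘ ε)) (List.length-tabulate (β ∘ ε))))
        (proj₂ (proj₂ (proj₂ (proj₂ result))) (lookup-tabulate-⊆ ys (λ x → inject≤ (ε x) b≤) (λ x y x<y →
          subst₂ _<_ (sym (Fin.toℕ-inject≤ (ε x) b≤)) (sym (Fin.toℕ-inject≤ (ε y) b≤)) (ε-mono x y x<y)))
          (List.length-tabulate (β ∘ ε)))
    where
    toFun : ∀ (zs : List (Fin N)) → length zs ≡ a → Fin a → Fin N
    toFun zs p j = List.lookup zs (cast (sym p) j)

    χ : List (Fin N) → Fin (suc r)
    χ zs with length zs ℕ.≟ a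
    ... | yes p = κ (toFun zs p)
    -- Default colour; homogeneity is only used for lists of length `a`.
    ... | no _  = zero

    χ-toFun : ∀ zs p → χ zs ≡ κ (toFun zs p)
    χ-toFun zs p with length zs ℕ.≟ a
    ... | yes q = refl
    ... | no ¬q = ⊥-elim (¬q p)

    result : ∃ λ ys → ys Sub.⊆ List.allFin N × b ≤ length ys × ∃ λ c → Homogeneous a χ c ys
    result = ram (List.allFin N) (ℕ.≤-reflexive (sym (List.length-tabulate id))) χ

    ys : List (Fin N)
    ys = proj₁ result

    b≤ : b ≤ length ys
    b≤ = proj₁ (proj₂ (proj₂ result))

    β : Fin b → Fin N
    β x = List.lookup ys (inject≤ x b≤)

    β-mono : StrictMono β
    β-mono x y x<y = AllPairs-lookup (AllPairs-resp-⊆ (proj₁ (proj₂ result)) (AllPairs.tabulate⁺-< id)) _ _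
      (subst₂ _<_ (sym (Fin.toℕ-inject≤ x b≤)) (sym (Fin.toℕ-inject≤ y b≤)) x<y)

-- Images of subsets

∈-tabulate⁺ : ∀ {n} {P : Fin n → Set} (P? : Decidable P) {x} → P x → x ∈ tabulate (λ y → ⌊ P? y ⌋)
∈-tabulate⁺ P? {x} p = lookup⇒[]= x _ (trans (lookup∘tabulate _ x) (trans (isYes≗does (P? x)) (dec-true (P? x) p)))

∈-tabulate⁻ : ∀ {n} {P : Fin n → Set} (P? : Decidable P) {x} → x ∈ tabulate (λ y → ⌊ P? y ⌋) → P x
∈-tabulate⁻ P? {x} x∈ with P? x | trans (sym (lookup∘tabulate (λ y → ⌊ P? y ⌋) x)) ([]=⇒lookup x∈)
... | yes p | _ = p

∈-image⁺ : ∀ {a b} (f : Fin a → Fin b) {S x} → x ∈ S → f x ∈ image f S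
∈-image⁺ f {S} x∈ = ∈-tabulate⁺ (λ y → any? (λ x → (x ∈? S) ×-dec (f x ≟ y))) (_ , x∈ , refl)

∈-image⁻ : ∀ {a b} (f : Fin a → Fin b) {S y} → y ∈ image f S → ∃ λ x → x ∈ S × f x ≡ y
∈-image⁻ f {S} = ∈-tabulate⁻ (λ y → any? (λ x → (x ∈? S) ×-dec (f x ≟ y)))

image-cong-⊆ : ∀ {a b} {f g : Fin a → Fin b} S → f ≗ g → image f S ⊆ image g S
image-cong-⊆ {f = f} {g} S p y∈ with ∈-image⁻ f y∈
... | x , x∈ , refl = subst (_∈ image g S) (sym (p x)) (∈-image⁺ g x∈)

image-cong : ∀ {a b} {f g : Fin a → Fin b} S → f ≗ g → image f S ≡ image g S
image-cong S p = ⊆-antisym (image-cong-⊆ S p) (image-cong-⊆ S (sym ∘ p))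

image-∘ : ∀ {a b c} (g : Fin b → Fin c) (f : Fin a → Fin b) S → image (g ∘ f) S ≡ image g (image f S)
image-∘ g f S = ⊆-antisym to from
  where
  to : image (g ∘ f) S ⊆ image g (image f S)
  to z∈ with ∈-image⁻ (g ∘ f) z∈
  ... | x , x∈ , refl = ∈-image⁺ g (∈-image⁺ f x∈)

  from : image g (image f S) ⊆ image (g ∘ f) S
  from z∈ with ∈-image⁻ g z∈
  ... | y , y∈ , refl with ∈-image⁻ f y∈
  ...   | x , x∈ , refl = ∈-image⁺ (g ∘ f) x∈

image-mono : ∀ {a b} (f : Fin a → Fin b) {S T} → S ⊆ T → image f S ⊆ image f T
image-mono f S⊆T y∈ with ∈-image⁻ f y∈
... | x , x∈ , refl = ∈-image⁺ f (S⊆T x∈)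

image-cancel-⊆ : ∀ {a b} {f : Fin a → Fin b} → Injective _≡_ _≡_ f → ∀ {S T} → image f S ⊆ image f T → S ⊆ T
image-cancel-⊆ {f = f} inj {S} {T} sub x∈ with ∈-image⁻ f (sub (∈-image⁺ f x∈))
... | y , y∈ , p = subst (_∈ T) (inj p) y∈

image-injective : ∀ {a b} {f : Fin a → Fin b} → Injective _≡_ _≡_ f → Injective _≡_ _≡_ (image f)
image-injective inj p = ⊆-antisym (image-cancel-⊆ inj (⊆-reflexive p)) (image-cancel-⊆ inj (⊆-reflexive (sym p)))

∣⁅x⁆∪p∣ : ∀ {n} (x : Fin n) p → x ∉ p → ∣ ⁅ x ⁆ ∪ p ∣ ≡ suc ∣ p ∣
∣⁅x⁆∪p∣ zero    (inside ∷ p)  x∉ = ⊥-elim (x∉ here)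
∣⁅x⁆∪p∣ zero    (outside ∷ p) x∉ = cong (suc ∘ ∣_∣) (∪-identityˡ p)
∣⁅x⁆∪p∣ (suc x) (inside ∷ p)  x∉ = cong suc (∣⁅x⁆∪p∣ x p (x∉ ∘ there))
∣⁅x⁆∪p∣ (suc x) (outside ∷ p) x∉ = ∣⁅x⁆∪p∣ x p (x∉ ∘ there)

∣image∣ : ∀ {a b} {f : Fin a → Fin b} → Injective _≡_ _≡_ f → ∀ S → ∣ image f S ∣ ≡ ∣ S ∣
∣image∣ {b = b} {f} inj [] = trans (cong ∣_∣ (⊆-antisym none ⊥⊆)) (∣⊥∣≡0 b)
  where
  none : image f [] ⊆ ⊥
  none y∈ with ∈-image⁻ f {[]} y∈
  ... | () , _
∣image∣ {f = f} inj (outside ∷ S) = trans (cong ∣_∣ (⊆-antisym to from)) (∣image∣ (Fin.suc-injective ∘ inj) S)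
  where
  to : image f (outside ∷ S) ⊆ image (f ∘ suc) S
  to y∈ with ∈-image⁻ f y∈
  ... | suc x , there x∈ , refl = ∈-image⁺ (f ∘ suc) x∈

  from : image (f ∘ suc) S ⊆ image f (outside ∷ S)
  from y∈ with ∈-image⁻ (f ∘ suc) y∈
  ... | x , x∈ , refl = ∈-image⁺ f (there x∈)
∣image∣ {f = f} inj (inside ∷ S) = trans (cong ∣_∣ (⊆-antisym to from))
  (trans (∣⁅x⁆∪p∣ (f zero) (image (f ∘ suc) S) fresh) (cong suc (∣image∣ (Fin.suc-injective ∘ inj) S)))
  where
  to : image f (inside ∷ S) ⊆ ⁅ f zero ⁆ ∪ image (f ∘ suc) S
  to y∈ with ∈-image⁻ f y∈
  ... | zero  , _        , refl = p⊆p∪q _ (x∈⁅x⁆ (f zero))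
  ... | suc x , there x∈ , refl = q⊆p∪q ⁅ f zero ⁆ _ (∈-image⁺ (f ∘ suc) x∈)

  from : ⁅ f zero ⁆ ∪ image (f ∘ suc) S ⊆ image f (inside ∷ S)
  from y∈ with x∈p∪q⁻ ⁅ f zero ⁆ _ y∈
  ... | inj₁ y∈₁ with x∈⁅y⁆⇒x≡y _ y∈₁
  ...   | refl = ∈-image⁺ f here
  from y∈ | inj₂ y∈₂ with ∈-image⁻ (f ∘ suc) y∈₂
  ...   | x , x∈ , refl = ∈-image⁺ f (there x∈)

  fresh : f zero ∉ image (f ∘ suc) S
  fresh z∈ with ∈-image⁻ (f ∘ suc) z∈
  ... | x , _ , p with inj p
  ...   | ()

pullback : ∀ {a b} {f : Fin a → Fin b} → Injective _≡_ _≡_ f → ∀ T → T ⊆ image f ⊤ →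
  ∃ λ S → image f S ≡ T × ∣ S ∣ ≡ ∣ T ∣
pullback {f = f} inj T T⊆ = S , eq , trans (sym (∣image∣ inj S)) (cong ∣_∣ eq)
  where
  S : Subset _
  S = tabulate (λ x → ⌊ f x ∈? T ⌋)

  to : image f S ⊆ T
  to y∈ with ∈-image⁻ f y∈
  ... | x , x∈ , refl = ∈-tabulate⁻ (λ x → f x ∈? T) x∈

  from : T ⊆ image f S
  from y∈ with ∈-image⁻ f (T⊆ y∈)
  ... | x , _ , refl = ∈-image⁺ f (∈-tabulate⁺ (λ x → f x ∈? T) y∈)

  eq : image f S ≡ T
  eq = ⊆-antisym to from

subsetOfSize : ∀ {n} t (M : Subset n) → t ≤ ∣ M ∣ → ∃ λ S → S ⊆ M × ∣ S ∣ ≡ t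
subsetOfSize {n} zero M             _  = ⊥ , ⊥⊆ , ∣⊥∣≡0 n
subsetOfSize (suc t) (inside ∷ M)  le with subsetOfSize t M (s≤s⁻¹ le)
... | S , S⊆ , p = inside ∷ S , s⊆s S⊆ , cong suc p
subsetOfSize (suc t) (outside ∷ M) le with subsetOfSize (suc t) M le
... | S , S⊆ , p = outside ∷ S , s⊆s S⊆ , p

-- Increasing enumeration of a subset

enum : ∀ {n} (M : Subset n) → Fin ∣ M ∣ → Fin n
enum (inside ∷ M)  zero    = zero
enum (inside ∷ M)  (suc i) = suc (enum M i)
enum (outside ∷ M) i       = suc (enum M i)

enum-mono : ∀ {n} (M : Subset n) → StrictMono (enum M)
enum-mono (inside ∷ M)  zero    (suc j) lt = s≤s z≤n
enum-mono (inside ∷ M)  (suc i) (suc j) lt = s≤s (enum-mono M i j (s≤s⁻¹ lt))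
enum-mono (outside ∷ M) i       j       lt = s≤s (enum-mono M i j lt)

enum-∈ : ∀ {n} (M : Subset n) i → enum M i ∈ M
enum-∈ (inside ∷ M)  zero    = here
enum-∈ (inside ∷ M)  (suc i) = there (enum-∈ M i)
enum-∈ (outside ∷ M) i       = there (enum-∈ M i)

enum-surjective : ∀ {n} (M : Subset n) {x} → x ∈ M → ∃ λ i → enum M i ≡ x
enum-surjective (inside ∷ M)  here       = zero , refl
enum-surjective (inside ∷ M)  (there x∈) = let i , p = enum-surjective M x∈ in suc i , cong suc p
enum-surjective (outside ∷ M) (there x∈) = let i , p = enum-surjective M x∈ in i , cong suc p

enumerate : ∀ {n k} (M : Subset n) → ∣ M ∣ ≡ k → Fin k → Fin n
enumerate M |M| i = enum M (cast (sym |M|) i)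

enumerate-mono : ∀ {n k} (M : Subset n) (|M| : ∣ M ∣ ≡ k) → StrictMono (enumerate M |M|)
enumerate-mono M |M| i j lt = enum-mono M _ _
  (subst₂ _<_ (sym (Fin.toℕ-cast (sym |M|) i)) (sym (Fin.toℕ-cast (sym |M|) j)) lt)

enumerate-image : ∀ {n k} (M : Subset n) (|M| : ∣ M ∣ ≡ k) → image (enumerate M |M|) ⊤ ≡ M
enumerate-image M |M| = ⊆-antisym to from
  where
  to : image (enumerate M |M|) ⊤ ⊆ M
  to y∈ with ∈-image⁻ (enumerate M |M|) y∈
  ... | i , _ , refl = enum-∈ M _

  from : M ⊆ image (enumerate M |M|) ⊤
  from {y} y∈ with enum-surjective M y∈
  ... | i , refl = subst (_∈ image (enumerate M |M|) ⊤) (cong (enum M) (cast-involutive (sym |M|) |M| i))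
    (∈-image⁺ (enumerate M |M|) {x = cast |M| i} ∈⊤)

-- Each map takes only values of the other, so each is pointwise below the other. Hence blocks kept
-- as increasing tuples agree as soon as their underlying sets do.
strictMono-unique : ∀ {k n} {f g : Fin k → Fin n} → StrictMono f → StrictMono g → image f ⊤ ≡ image g ⊤ → f ≗ g
strictMono-unique {f = f} {g} mf mg p x = Fin.≤-antisym
  (strictMono-≤-pointwise mg mf (covered (sym p)) x) (strictMono-≤-pointwise mf mg (covered p) x)
  where
  covered : ∀ {h h′ : Fin _ → Fin _} → image h ⊤ ≡ image h′ ⊤ → ∀ x → ∃ λ y → h′ y ≡ h x
  covered {h} {h′} p x with ∈-image⁻ h′ (⊆-reflexive p (∈-image⁺ h {x = x} ∈⊤))
  ... | y , _ , q = y , q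

-- Hypergraphs and their Hales–Jewett powers

-- Blocks form an indexed family, so that in layers and powers an index can remember the copy from
-- which its block comes.
record Hypergraph (k : ℕ) (V : Set) : Set₁ where
  field
    Index : Set
    block : Index → Fin k → V

open Hypergraph

Preserves : ∀ {k V W} → Hypergraph k V → Hypergraph k W → (V → W) → Set
Preserves G H f = ∀ i → ∃ λ j → block H j ≗ f ∘ block G i

-- J collects t places of the block at which it meets the image of f.
Reflects : ∀ {k} → ℕ → ∀ {V W} → Hypergraph k V → Hypergraph k W → (V → W) → Set
Reflects t G H f = ∀ j J → ∣ J ∣ ≡ t → (∀ {x} → x ∈ J → ∃ λ u → block H j x ≡ f u) →
  ∃ λ i → block H j ≗ f ∘ block G i

record Strong {k} (t : ℕ) {V W} (G : Hypergraph k V) (H : Hypergraph k W) (f : V → W) : Set where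
  field
    injective : Injective _≡_ _≡_ f
    preserves : Preserves G H f
    reflects  : Reflects t G H f

open Strong

strong-id : ∀ {k t V} {G : Hypergraph k V} → Strong t G G id
strong-id .injective           = id
strong-id .preserves i         = i , λ _ → refl
strong-id .reflects j J _ _    = j , λ _ → refl

strong-∘ : ∀ {k t V W X} {G : Hypergraph k V} {H : Hypergraph k W} {K : Hypergraph k X} {g : W → X} {f : V → W} →
  Strong t H K g → Strong t G H f → Strong t G K (g ∘ f)
strong-∘ sg sf .injective = injective sf ∘ injective sg
strong-∘ {g = g} sg sf .preserves i with preserves sf i
... | j , p with preserves sg j
...   | l , q = l , λ x → trans (q x) (cong g (p x))
strong-∘ {g = g} sg sf .reflects l J |J| meets with reflects sg l J |J| (λ x∈J → let u , p = meets x∈J in _ , p)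
... | j , q with reflects sf j J |J| (λ {x} x∈J → let u , p = meets x∈J in u , injective sg (trans (sym (q x)) p))
...   | i , p = i , λ x → trans (q x) (cong g (p x))

strong-≗ : ∀ {k t V W} {G : Hypergraph k V} {H : Hypergraph k W} {f g : V → W} → f ≗ g → Strong t G H f → Strong t G H g
strong-≗ f≗g s .injective p   = injective s (trans (f≗g _) (trans p (sym (f≗g _))))
strong-≗ f≗g s .preserves i   = let j , p = preserves s i in j , λ x → trans (p x) (f≗g _)
strong-≗ f≗g s .reflects j J |J| meets =
  let i , p = reflects s j J |J| (λ x∈J → let u , q = meets x∈J in u , trans q (sym (f≗g u))) in
  i , λ x → trans (p x) (f≗g _)

member : ∀ {k t} → 1 ≤ t → ∀ {J : Subset k} → ∣ J ∣ ≡ t → ∃ (_∈ J)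
member {k} {suc t} _ {J} |J| with nonempty? J
... | yes p = p
... | no ¬p with trans (sym |J|) (trans (cong ∣_∣ (Empty-unique ¬p)) (∣⊥∣≡0 k))
...   | ()

layers : ∀ {k V} (Y : Set) → Hypergraph k V → Hypergraph k (Y × V)
layers Y G .Index           = Y × Index G
layers Y G .block (y , i) x = y , block G i x

-- Every block stays in one layer, and as `t` is positive a vertex of `J` tells which layer it is.
layer-strong : ∀ {k t} → 1 ≤ t → ∀ {V Y} {G : Hypergraph k V} (y : Y) → Strong t G (layers Y G) (y ,_)
layer-strong _   y .injective refl  = refl
layer-strong _   y .preserves i     = (y , i) , λ _ → refl
layer-strong 1≤t y .reflects (y′ , i) J |J| meets with member 1≤t |J|
... | x , x∈J with meets x∈J
...   | u , refl = i , λ _ → refl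

-- This is `Reflects` for `e` with the blocks of `H` seen only through `π`. In this form
-- `word-reflects` yields it for all pictures whose blocks project to blocks of the power.
Closed : ∀ {k} → ℕ → ∀ {a V} {D : Set} → Hypergraph k (Fin a) → Hypergraph k V → (V → D) → (Fin a → D) → Set
Closed t A H π e = ∀ i J → ∣ J ∣ ≡ t → (∀ {x} → x ∈ J → ∃ λ u → π (block H i x) ≡ e u) →
  ∃ λ E → π ∘ block H i ≗ e ∘ block A E

-- One copy of H for every line L, glued along the vertices over e: the vertex v over e j becomes the
-- word that is v at the moving coordinates of L and α c j where L has the letter c. The summand
-- Line × V holds the vertices not over e; its remaining elements are junk that lies in no block.
module Power {k t a : ℕ} (A : Hypergraph k (Fin a)) {V D : Set} (H : Hypergraph k V)
  (π : V → D) (_≟_ : DecidableEquality D) (e : Fin a → D) (e-injective : Injective _≡_ _≡_ e)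
  {q : ℕ} (α : Fin q → Fin a → V) (α-strong : ∀ c → Strong t A H (α c)) (α-over : ∀ c j → π (α c j) ≡ e j)
  (m : ℕ) where

  Line : Set
  Line = Vec (Maybe (Fin q)) m

  Vertex : Set
  Vertex = (Fin a × Vec V m) ⊎ (Line × V)

  coord : Maybe (Fin q) → Fin a → V → V
  coord nothing  j v = v
  coord (just c) j v = α c j

  part : V → Maybe (Fin a)
  part v with any? (λ j → e j ≟ π v)
  ... | yes (j , _) = just j
  ... | no _        = nothing

  part-just : ∀ {v j} → part v ≡ just j → π v ≡ e j
  part-just {v} p with any? (λ j → e j ≟ π v)
  part-just refl | yes (j , q) = sym q

  part-over : ∀ {v j} → π v ≡ e j → part v ≡ just j
  part-over {v} {j} p with any? (λ j → e j ≟ π v)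
  ... | yes (l , q) = cong just (e-injective (trans q p))
  ... | no ¬q       = ⊥-elim (¬q (j , sym p))

  place : Line → V → Maybe (Fin a) → Vertex
  place L v (just j) = inj₁ (j , tabulate (λ i → coord (lookup L i) j v))
  place L v nothing  = inj₂ (L , v)

  embed : Line → V → Vertex
  embed L v = place L v (part v)

  ρ : Vertex → D
  ρ (inj₁ (j , _)) = e j
  ρ (inj₂ (_ , v)) = π v

  ρ-embed : ∀ L v → ρ (embed L v) ≡ π v
  ρ-embed L v with part v in eq
  ... | just j  = sym (part-just eq)
  ... | nothing = refl

  -- A line without a moving coordinate would send all vertices over `e j` to a single word.
  Moves : Set
  Moves = Σ Line Moving

  power : Hypergraph k Vertex
  power .Index           = Moves × Index H
  power .block (l , i) x = embed (proj₁ l) (block H i x)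

  word : Vec (Fin q) m → Fin a → Vertex
  word w j = inj₁ (j , tabulate (λ i → α (lookup w i) j))

  word-injective : ∀ w → Injective _≡_ _≡_ (word w)
  word-injective w p = cong proj₁ (inj₁-injective p)

  -- The link to Hales-Jewett: at a moving coordinate `α c j` stays, at a letter `d` it becomes
  -- `α d j`, which together spell the word with `c` substituted.
  embed-letter : ∀ L c → embed L ∘ α c ≗ word (L ⟨ c ⟩)
  embed-letter L c j = trans (cong (place L (α c j)) (part-over (α-over c j)))
    (cong (λ w → inj₁ (j , w)) (tabulate-cong λ i →
      trans (coord-letter (lookup L i)) (cong (λ d → α d j) (sym (lookup-map i (fromMaybe c) L)))))
    where
    coord-letter : ∀ y → coord y j (α c j) ≡ α (fromMaybe c y) j
    coord-letter nothing  = refl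
    coord-letter (just d) = refl

  embed-over : ∀ L {v j} → π v ≡ e j → embed L v ≡ inj₁ (j , tabulate (λ i → coord (lookup L i) j v))
  embed-over L {v} p = cong (place L v) (part-over p)

  embed-inj₁ : ∀ L v {j w} → embed L v ≡ inj₁ (j , w) → π v ≡ e j × (∀ i → coord (lookup L i) j v ≡ lookup w i)
  embed-inj₁ L v p with part v in eq
  embed-inj₁ L v refl | just j = part-just eq , λ i → sym (lookup∘tabulate _ i)

  embed-inj₂ : ∀ L v {x} → embed L v ≡ inj₂ x → x ≡ (L , v)
  embed-inj₂ L v p with part v
  embed-inj₂ L v refl | nothing = refl

  -- A vertex over `e` can be read off its word at the moving coordinate; any other vertex is stored
  -- unchanged.
  embed-injective : ∀ {L} → Moving L → Injective _≡_ _≡_ (embed L)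
  embed-injective {L} (i₀ , mv) {u} {v} p with embed L v in eq
  ... | inj₂ x = cong proj₂ (trans (sym (embed-inj₂ L u p)) (embed-inj₂ L v eq))
  ... | inj₁ (j , w) = trans (unmoved u p) (sym (unmoved v eq))
    where
    unmoved : ∀ v → embed L v ≡ inj₁ (j , w) → v ≡ lookup w i₀
    unmoved v p = subst (λ y → coord y j v ≡ lookup w i₀) mv (proj₂ (embed-inj₁ L v p) i₀)

  Over : Index H → Index A → Set
  Over i E = ∀ x → π (block H i x) ≡ e (block A E x)

  -- One coordinate of an embedded block over `E` is again a block of `H`: the block itself if the
  -- coordinate moves, the copy of `E` under the letter otherwise.
  column : ∀ y {i E} → Over i E →
    ∃ λ i′ → Over i′ E × (∀ x → block H i′ x ≡ coord y (block A E x) (block H i x))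
  column nothing  {i}     o = i , o , λ x → refl
  column (just c) {i} {E} o with preserves (α-strong c) E
  ... | i′ , p = i′ , (λ x → trans (cong π (p x)) (α-over c _)) , p

  -- The letter is strong, so the block is α c ∘ E′ for some E′, and injectivity of e identifies E′ with E.
  rigid : ∀ c {i E J} → Over i E → ∣ J ∣ ≡ t → (∀ {x} → x ∈ J → block H i x ≡ α c (block A E x)) →
    ∀ x → block H i x ≡ α c (block A E x)
  rigid c {i} {E} {J} o |J| agree x with reflects (α-strong c) i J |J| (λ x∈J → _ , agree x∈J)
  ... | E′ , p = trans (p x) (cong (α c) (e-injective (trans (sym (α-over c _)) (trans (cong π (sym (p x))) (o x)))))

  -- Two lines have the entries `y` and `z` at one coordinate, and `y₀` is the entry of the first
  -- where the second is known to move. If `y` or `z` is a letter, `rigid` spreads the agreement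
  -- from `J` to the whole block. If both move, the blocks `i` and `j` must be equal: either `y₀`
  -- moves as well, or `j` comes from a letter and `rigid` applies again.
  cellwise : ∀ y y₀ z {i j E J} → Over i E → Over j E →
    (∀ x → block H j x ≡ coord y₀ (block A E x) (block H i x)) → ∣ J ∣ ≡ t →
    (∀ {x} → x ∈ J → coord y (block A E x) (block H i x) ≡ coord z (block A E x) (block H j x)) →
    ∀ x → coord y (block A E x) (block H i x) ≡ coord z (block A E x) (block H j x)
  cellwise y y₀ (just c) o jo jK |J| agree x with column y o
  ... | i′ , o′ , p = trans (sym (p x)) (rigid c o′ |J| (λ x∈J → trans (p _) (agree x∈J)) x)
  cellwise (just c) y₀       nothing o jo jK |J| agree x = sym (rigid c jo |J| (λ x∈J → sym (agree x∈J)) x)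
  cellwise nothing  nothing  nothing o jo jK |J| agree x = sym (jK x)
  cellwise nothing  (just c) nothing o jo jK |J| agree x =
    trans (rigid c o |J| (λ x∈J → trans (agree x∈J) (jK _)) x) (sym (jK x))

  -- At the moving coordinate the block meets a letter in `t` places, so it is the copy of some `E`
  -- under that letter. Every other coordinate is then a block over `E` that agrees with its letter
  -- on `J`, and `rigid` finishes.
  word-reflects : ∀ w → Reflects t A power (word w)
  word-reflects w ((L , i₀ , mv) , i) J |J| meets = E , λ x → trans (embed-over L (o x))
      (cong (λ u → inj₁ (block A E x , u)) (tabulate-cong λ l → cell l x))
    where
    meet : ∀ {x} → x ∈ J → ∃ λ u → π (block H i x) ≡ e u × (∀ l → coord (lookup L l) u (block H i x) ≡ α (lookup w l) u)
    meet {x} x∈J = let u , p = meets x∈J; p₁ , p₂ = embed-inj₁ L (block H i x) p in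
      u , p₁ , λ l → trans (p₂ l) (lookup∘tabulate _ l)

    unmoved : ∀ {x} (x∈J : x ∈ J) → block H i x ≡ α (lookup w i₀) (proj₁ (meet x∈J))
    unmoved {x} x∈J = let u , _ , p = meet x∈J in
      subst (λ y → coord y u (block H i x) ≡ α (lookup w i₀) u) mv (p i₀)

    base : ∃ λ E → block H i ≗ α (lookup w i₀) ∘ block A E
    base = reflects (α-strong (lookup w i₀)) i J |J| (λ x∈J → _ , unmoved x∈J)

    E : Index A
    E = proj₁ base

    o : Over i E
    o x = trans (cong π (proj₂ base x)) (α-over _ _)

    cell : ∀ l x → coord (lookup L l) (block A E x) (block H i x) ≡ α (lookup w l) (block A E x)
    cell l x with column (lookup L l) o
    ... | i′ , o′ , p = trans (sym (p x)) (rigid (lookup w l) o′ |J| agree x)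
      where
      agree : ∀ {x} → x ∈ J → block H i′ x ≡ α (lookup w l) (block A E x)
      agree {x} x∈J with meet x∈J
      ... | u , q , r with e-injective (trans (sym q) (o x))
      ...   | refl = trans (p x) (r l)

  module _ (closed : Closed t A H π e) where

    -- A vertex of `J` outside the part over `e` carries its line, which forces `K` to be `L`. If
    -- there is none, `closed` places the whole block over some `E`, and the coordinates are
    -- compared one by one.
    embed-reflects : ∀ L → Moving L → Reflects t H power (embed L)
    embed-reflects L (i₀ , mv) ((K , _) , i) J |J| meets with any? (λ x → (x ∈? J) ×-dec outside? x)
      where
      outside? : Decidable (λ x → part (block H i x) ≡ nothing)
      outside? x with part (block H i x)
      ... | just _  = no λ ()
      ... | nothing = yes refl
    ... | yes (x , x∈J , out) with meets x∈J
    ...   | u , p with embed-inj₂ L u (trans (sym p) (cong (place K (block H i x)) out))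
    ...     | refl = i , λ _ → refl
    embed-reflects L (i₀ , mv) ((K , _) , i) J |J| meets | no none-outside = j , λ x → trans (embed-over K (o x))
        (trans (cong (λ u → inj₁ (block A E x , u)) (tabulate-cong λ l → cell l x)) (sym (embed-over L (jo x))))
      where
      located : ∀ {x} → x ∈ J → ∃ λ u → π (block H i x) ≡ e u
      located {x} x∈J with part (block H i x) in eq
      ... | just u  = u , part-just eq
      ... | nothing = ⊥-elim (none-outside (x , x∈J , eq))

      E : Index A
      E = proj₁ (closed i J |J| located)

      o : Over i E
      o = proj₂ (closed i J |J| located)

      meet : ∀ {x} (x∈J : x ∈ J) → ∀ l →
        coord (lookup K l) (block A E x) (block H i x) ≡ coord (lookup L l) (block A E x) (proj₁ (meets x∈J))
      meet {x} x∈J l with meets x∈J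
      ... | u , p with embed-inj₁ L u (trans (sym p) (embed-over K (o x)))
      ...   | _ , q = sym (trans (q l) (lookup∘tabulate _ l))

      unmoved : ∀ {x} (x∈J : x ∈ J) → coord (lookup K i₀) (block A E x) (block H i x) ≡ proj₁ (meets x∈J)
      unmoved {x} x∈J = trans (meet x∈J i₀) (cong (λ y → coord y (block A E x) (proj₁ (meets x∈J))) mv)

      -- The preimage under `embed L` can only be what the line `K` shows at `i₀`, where `L` leaves
      -- vertices unchanged.
      base : ∃ λ j → Over j E × (∀ x → block H j x ≡ coord (lookup K i₀) (block A E x) (block H i x))
      base = column (lookup K i₀) o

      j : Index H
      j = proj₁ base

      jo : Over j E
      jo = proj₁ (proj₂ base)

      jK : ∀ x → block H j x ≡ coord (lookup K i₀) (block A E x) (block H i x)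
      jK = proj₂ (proj₂ base)

      cell : ∀ l x → coord (lookup K l) (block A E x) (block H i x) ≡ coord (lookup L l) (block A E x) (block H j x)
      cell l = cellwise (lookup K l) (lookup K i₀) (lookup L l) o jo jK |J| λ {x} x∈J →
        trans (meet x∈J l) (cong (coord (lookup L l) (block A E x)) (sym (trans (jK x) (unmoved x∈J))))

    embed-strong : ∀ L → Moving L → Strong t H power (embed L)
    embed-strong L mv .injective   = embed-injective mv
    embed-strong L mv .preserves i = ((L , mv) , i) , λ _ → refl
    embed-strong L mv .reflects    = embed-reflects L mv

-- Partite construction

-- Copies are functions that get compared only pointwise, so colourings have to be insensitive to
-- the difference.
Respects : ∀ {X Y Z : Set} → ((X → Y) → Z) → Set
Respects χ = ∀ {f g} → f ≗ g → χ f ≡ χ g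

module Partite {k t a : ℕ} (1≤t : 1 ≤ t) (A : Hypergraph k (Fin a)) (r : ℕ) where

  -- A picture of the partite construction over the base `D`; the listed copies of `A` are those
  -- that will be made monochromatic.
  record System (D : Set) : Set₁ where
    field
      {Vertex}         : Set
      hypergraph       : Hypergraph k Vertex
      π                : Vertex → D
      vertices         : Listed Vertex
      indices          : Listed (Index hypergraph)
      copies           : List (Fin a → Vertex)
      copies-strong    : ∀ {f} → f Mem.∈ copies → Strong t A hypergraph f

  open System

  -- `cover` is carried along so that in the end every block lies in a strong copy of `B`; the bound
  -- on blocks through `t` vertices rests on it.
  record Extension {D} (P P′ : System D) : Set₁ where
    field
      {Name}     : Set
      map        : Name → Vertex P → Vertex P′
      map-π      : ∀ l v → π P′ (map l v) ≡ π P v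
      map-strong : ∀ l → Strong t (hypergraph P) (hypergraph P′) (map l)
      map-copies : ∀ l {f} → f Mem.∈ copies P → map l ∘ f Mem.∈ copies P′
      cover      : ∀ i′ → ∃ λ l → ∃ λ i → block (hypergraph P′) i′ ≗ map l ∘ block (hypergraph P) i

  open Extension

  Colouring : ∀ {D} → System D → Set
  Colouring P = Σ ((Fin a → Vertex P) → Fin (suc r)) Respects

  MonochromaticOver : ∀ {D} (P : System D) → ((Fin a → Vertex P) → Fin (suc r)) → (Fin a → D) → Set
  MonochromaticOver P χ e = ∀ {f g} → f Mem.∈ copies P → g Mem.∈ copies P → π P ∘ f ≗ e → π P ∘ g ≗ e → χ f ≡ χ g

  RamseyOver : ∀ {D} {P P′ : System D} → Extension P P′ → List (Fin a → D) → Set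
  RamseyOver {P = P} {P′} E es = ∀ ((χ , _) : Colouring P′) → ∃ λ l →
    ∀ {e} → e Mem.∈ es → MonochromaticOver P (λ f → χ (map E l ∘ f)) e

  extension-id : ∀ {D} {P : System D} → Extension P P
  extension-id .Name             = Unit.⊤
  extension-id .map _            = id
  extension-id .map-π _ _        = refl
  extension-id .map-strong _     = strong-id
  extension-id .map-copies _ f∈  = f∈
  extension-id .cover i          = tt , i , λ _ → refl

  extension-∘ : ∀ {D} {P Q R : System D} → Extension Q R → Extension P Q → Extension P R
  extension-∘ F E .Name                 = Name F × Name E
  extension-∘ F E .map (m , l)          = map F m ∘ map E l
  extension-∘ F E .map-π (m , l) v      = trans (map-π F m _) (map-π E l v)
  extension-∘ F E .map-strong (m , l)   = strong-∘ (map-strong F m) (map-strong E l)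
  extension-∘ F E .map-copies (m , l) f∈ = map-copies F m (map-copies E l f∈)
  extension-∘ F E .cover i″ with cover F i″
  ... | m , i′ , p with cover E i′
  ...   | l , i , q = (m , l) , i , λ x → trans (p x) (cong (map F m) (q x))

  module _ {D : Set} (Good : System D → Set)
    (good-resp : ∀ {P P′ : System D} → Extension P P′ → Good P → Good P′) (Ok : (Fin a → D) → Set)
    (step : ∀ P → Good P → ∀ e → Ok e → ∃ λ P′ → Σ (Extension P P′) λ E → RamseyOver E (e ∷ [])) where

    -- A colouring of the last picture is pulled back first to `P₁`, homogeneous over `es`, and then
    -- to `P`, homogeneous over `e`. The second pullback keeps the first gain because extension maps
    -- preserve projections and listed copies.
    iterate : ∀ es → All Ok es → ∀ P → Good P → ∃ λ P′ → Σ (Extension P P′) λ E → RamseyOver E es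
    iterate []       []         P good = P , extension-id , λ χ → tt , λ ()
    iterate (e ∷ es) (ok ∷ oks) P good with step P good e ok
    ... | P₁ , E₁ , ramsey₁ with iterate es oks P₁ (good-resp E₁ good)
    ...   | P₂ , E₂ , ramsey₂ = P₂ , extension-∘ E₂ E₁ , find
      where
      find : RamseyOver (extension-∘ E₂ E₁) (e ∷ es)
      find (χ , resp) with ramsey₂ (χ , resp)
      ... | m , mono₂ with ramsey₁ ((λ f → χ (map E₂ m ∘ f)) , λ f≗g → resp (λ j → cong (map E₂ m) (f≗g j)))
      ...   | l , mono₁ = (m , l) , λ where
              (here refl) → mono₁ (here refl)
              (there e∈) f∈ g∈ p q → mono₂ e∈ (map-copies E₁ l f∈) (map-copies E₁ l g∈)
                (λ j → trans (map-π E₁ l _) (p j)) (λ j → trans (map-π E₁ l _) (q j))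

  module ColourOver {D : Set} (_≟_ : DecidableEquality D) (P : System D)
    (χ : (Fin a → Vertex P) → Fin (suc r)) where

    over? : ∀ e (f : Fin a → Vertex P) → Dec (π P ∘ f ≗ e)
    over? e f = all? λ j → π P (f j) ≟ e j

    colourOver : (Fin a → D) → Fin (suc r)
    colourOver e with Any.any? (over? e) (copies P)
    ... | yes p = χ (proj₁ (Mem.find p))
    -- Default colour when no listed copy lies over `e`.
    ... | no _  = zero

    colourOver-≡ : ∀ {e f} → MonochromaticOver P χ e → f Mem.∈ copies P → π P ∘ f ≗ e → χ f ≡ colourOver e
    colourOver-≡ {e} mono f∈ p with Any.any? (over? e) (copies P)
    ... | yes q = mono f∈ (proj₁ (proj₂ (Mem.find q))) p (proj₂ (proj₂ (Mem.find q)))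
    ... | no ¬q = ⊥-elim (¬q (Mem.lose f∈ p))

  module Step {D : Set} (_≟_ : DecidableEquality D) (P : System D) (e : Fin a → D)
    (e-injective : Injective _≡_ _≡_ e) where

    over : List (Fin a → Vertex P)
    over = filter (λ f → all? λ j → π P (f j) ≟ e j) (copies P)

    q : ℕ
    q = length over

    α : Fin q → Fin a → Vertex P
    α = List.lookup over

    α-filtered : ∀ c → α c Mem.∈ copies P × π P ∘ α c ≗ e
    α-filtered c = ∈-filter⁻ _ (∈-lookup {xs = over} c)

    letter : ∀ {f} → f Mem.∈ copies P → π P ∘ f ≗ e → ∃ λ c → f ≡ α c
    letter f∈ p = let f∈over = ∈-filter⁺ _ f∈ p in index f∈over , lookup-index f∈over

    m : ℕ
    m = proj₁ (halesJewett q (suc r))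

    open Power A (hypergraph P) (π P) _≟_ e e-injective α (λ c → copies-strong P (proj₁ (α-filtered c)))
      (λ c → proj₂ (α-filtered c)) m renaming (Vertex to PowerVertex) public

    moves : Listed Moves
    moves = listedMap (λ ((L , i) , p) → L , i , p) (λ (L , i , p) → (L , i) , p) (λ _ → refl)
      (listedΣ (λ (L , i) → nothing? (lookup L i)) (λ _ → uip)
        (listed× (listedVec (listedMaybe (listedFin q)) m) (listedFin m)))
      where
      nothing? : (y : Maybe (Fin q)) → Dec (y ≡ nothing)
      nothing? nothing  = yes refl
      nothing? (just _) = no λ ()

    powerVertices : Listed PowerVertex
    powerVertices = listed⊎ (listed× (listedFin a) (listedVec (vertices P) m))
      (listed× (listedVec (listedMaybe (listedFin q)) m) (vertices P))

    powerIndices : Listed (Index power)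
    powerIndices = listed× moves (indices P)

  module ClosedStep {D : Set} (_≟_ : DecidableEquality D) (P : System D) (e : Fin a → D)
    (e-injective : Injective _≡_ _≡_ e) (closed : Closed t A (hypergraph P) (π P) e) where

    open Step _≟_ P e e-injective

    powerSystem : System D
    powerSystem .Vertex     = PowerVertex
    powerSystem .hypergraph = power
    powerSystem .π          = ρ
    powerSystem .vertices   = powerVertices
    powerSystem .indices    = powerIndices
    powerSystem .copies     = cartesianProductWith (λ l f → embed (proj₁ l) ∘ f) (elems moves) (copies P)
    powerSystem .copies-strong f∈ with ∈-cartesianProductWith⁻ (λ l f → embed (proj₁ l) ∘ f) (elems moves) (copies P) f∈
    ... | (L , mv) , f , _ , f∈P , refl = strong-∘ (embed-strong closed L mv) (copies-strong P f∈P)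

    powerExtension : Extension P powerSystem
    powerExtension .Name                 = Moves
    powerExtension .map (L , _)          = embed L
    powerExtension .map-π (L , _)        = ρ-embed L
    powerExtension .map-strong (L , mv)  = embed-strong closed L mv
    powerExtension .map-copies l f∈      = ∈-cartesianProductWith⁺ (λ l f → embed (proj₁ l) ∘ f) (complete moves l) f∈
    powerExtension .cover (l , i)        = l , i , λ _ → refl

    -- Words are coloured as copies of `A` in the power. By `embed-letter`, the copies over `e` in
    -- the copy of `P` along a monochromatic line are exactly the words of that line.
    powerRamsey : RamseyOver powerExtension (e ∷ [])
    powerRamsey (χ , resp) with proj₂ (halesJewett q (suc r)) (χ ∘ word)
    ... | L , mv , mono = (L , mv) , λ { (here refl) f∈ g∈ p q → find (letter f∈ p) (letter g∈ q) }
      where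
      find : ∀ {f g} → (∃ λ c → f ≡ α c) → (∃ λ d → g ≡ α d) → χ (embed L ∘ f) ≡ χ (embed L ∘ g)
      find (c , refl) (d , refl) = trans (resp (embed-letter L c)) (trans (mono c d) (sym (resp (embed-letter L d))))

  module PartiteStep {D : Set} (_≟_ : DecidableEquality D) (P : System D) (e : Fin a → D)
    (e-injective : Injective _≡_ _≡_ e) where

    open Step _≟_ P e e-injective

    -- Here the power is only a base: the copies of `P` for different lines are kept apart, and
    -- `embed` becomes the projection.
    spread : System PowerVertex
    spread .Vertex        = Moves × Vertex P
    spread .hypergraph    = layers Moves (hypergraph P)
    spread .π (l , v)     = embed (proj₁ l) v
    spread .vertices      = listed× moves (vertices P)
    spread .indices       = listed× moves (indices P)
    spread .copies        = cartesianProductWith (λ l f j → l , f j) (elems moves) (copies P)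
    spread .copies-strong f∈ with ∈-cartesianProductWith⁻ (λ l f j → l , f j) (elems moves) (copies P) f∈
    ... | l , f , _ , f∈P , refl = strong-∘ (layer-strong 1≤t l) (copies-strong P f∈P)

    Projects : System PowerVertex → Set
    Projects Q = ∀ i → ∃ λ i′ → π Q ∘ block (hypergraph Q) i ≗ block power i′

    projects-resp : ∀ {Q Q′} → Extension Q Q′ → Projects Q → Projects Q′
    projects-resp {Q} {Q′} E proj i′ with cover E i′
    ... | l , i , p with proj i
    ...   | j , q = j , λ x → trans (cong (π Q′) (p x)) (trans (map-π E l _) (q x))

    words : Listed (Vec (Fin q) m)
    words = listedVec (listedFin q) m

    targets : List (Fin a → PowerVertex)
    targets = List.map word (elems words)

    Target : (Fin a → PowerVertex) → Set
    Target e′ = Injective _≡_ _≡_ e′ × Reflects t A power e′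

    targets-ok : All Target targets
    targets-ok = All.tabulate λ e∈ → let w , _ , p = ∈-map⁻ word e∈ in
      subst Target (sym p) (word-injective w , word-reflects w)

    -- Blocks of `Q` project to blocks of the power, and there `e′` reflects blocks; so the part of
    -- `Q` over `e′` is closed and the power along it is strong.
    targetStep : ∀ Q → Projects Q → ∀ e′ → Target e′ → ∃ λ Q′ → Σ (Extension Q Q′) λ E → RamseyOver E (e′ ∷ [])
    targetStep Q proj e′ (inj , refl′) = powerSystem , powerExtension , powerRamsey
      where
      closed : Closed t A (hypergraph Q) (π Q) e′
      closed i J |J| meets with proj i
      ... | i′ , p with refl′ i′ J |J| (λ x∈J → let u , q = meets x∈J in u , trans (sym (p _)) q)
      ...   | E , q = E , λ x → trans (p x) (q x)

      open ClosedStep (_≟ᶜ_ powerVertices) Q e′ inj closed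

    module Cleaned {Q : System PowerVertex} (E : Extension spread Q) (ramsey : RamseyOver E targets) where

      clean : System D
      clean .Vertex        = Vertex Q
      clean .hypergraph    = hypergraph Q
      clean .π             = ρ ∘ π Q
      clean .vertices      = vertices Q
      clean .indices       = indices Q
      clean .copies        = copies Q
      clean .copies-strong = copies-strong Q

      cleanExtension : Extension P clean
      cleanExtension .Name                = Name E × Moves
      cleanExtension .map (n , l) v       = map E n (l , v)
      cleanExtension .map-π (n , l) v     = trans (cong ρ (map-π E n (l , v))) (ρ-embed (proj₁ l) v)
      cleanExtension .map-strong (n , l)  = strong-∘ (map-strong E n) (layer-strong 1≤t l)
      cleanExtension .map-copies (n , l) f∈ =
        map-copies E n (∈-cartesianProductWith⁺ (λ l f j → l , f j) (complete moves l) f∈)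
      cleanExtension .cover i′ with cover E i′
      ... | n , (l , i) , p = (n , l) , i , p

      -- In the copy `ν` of `spread`, the colour of a copy of `A` over a word depends on the word
      -- only. Hales-Jewett for these colours gives a line `L`, and the layer of `L` within `ν` is
      -- the required copy of `P`.
      cleanRamsey : RamseyOver cleanExtension (e ∷ [])
      cleanRamsey (χ , resp) = (ν , L , mv) , λ { (here refl) f∈ g∈ p q → find f∈ g∈ (letter f∈ p) (letter g∈ q) }
        where
        ν : Name E
        ν = proj₁ (ramsey (χ , resp))

        open ColourOver (_≟ᶜ_ powerVertices) spread (λ f → χ (map E ν ∘ f))

        line : MonoLine (colourOver ∘ word)
        line = proj₂ (halesJewett q (suc r)) (colourOver ∘ word)

        L : Line
        L = proj₁ line

        mv : Moving L
        mv = proj₁ (proj₂ line)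

        lift-colour : ∀ c → α c Mem.∈ copies P → χ (λ j → map E ν ((L , mv) , α c j)) ≡ colourOver (word (L ⟨ c ⟩))
        lift-colour c f∈ = colourOver-≡ (proj₂ (ramsey (χ , resp)) (∈-map⁺ word (complete words (L ⟨ c ⟩))))
          (∈-cartesianProductWith⁺ (λ l f j → l , f j) (complete moves (L , mv)) f∈) (embed-letter L c)

        find : ∀ {f g} → f Mem.∈ copies P → g Mem.∈ copies P → (∃ λ c → f ≡ α c) → (∃ λ d → g ≡ α d) →
          χ (λ j → map E ν ((L , mv) , f j)) ≡ χ (λ j → map E ν ((L , mv) , g j))
        find f∈ g∈ (c , refl) (d , refl) = trans (lift-colour c f∈) (trans (proj₂ (proj₂ line) c d) (sym (lift-colour d g∈)))

    partiteStep : ∃ λ P′ → Σ (Extension P P′) λ E → RamseyOver E (e ∷ [])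
    partiteStep with iterate Projects projects-resp Target targetStep targets targets-ok spread
      (λ (l , i) → (l , i) , λ _ → refl)
    ... | Q , E , ramsey = clean , cleanExtension , cleanRamsey
      where open Cleaned E ramsey

  partiteConstruction : ∀ {D} → DecidableEquality D → (P : System D) → ∀ es → All (Injective _≡_ _≡_) es →
    ∃ λ P′ → Σ (Extension P P′) λ E → RamseyOver E es
  partiteConstruction _≟_ P es inj = iterate (λ _ → Unit.⊤) (λ _ _ → tt) (Injective _≡_ _≡_)
    (λ P _ e e-inj → PartiteStep.partiteStep _≟_ P e e-inj) es inj P tt

-- From hypergraphs to designs

listedSubset : ∀ n → Listed (Subset n)
listedSubset = listedVec (listed (true List.∷ false List.∷ List.[]) λ { true → here refl ; false → there (here refl) })

module _ {k t μ : ℕ} where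

  blockGraph : (D : PDesign k t μ) → Hypergraph k (Fin (n D))
  blockGraph D .Index         = Σ (Subset (n D)) (Block D)
  blockGraph D .block (M , p) = enumerate M (blockSize D M p)

  listedBlocks : (D : PDesign k t μ) → Listed (Index (blockGraph D))
  listedBlocks D = listedΣ (λ M → T? (isBlock D M)) (λ M → Bool.T-irrelevant) (listedSubset (n D))

  block-mono : ∀ (D : PDesign k t μ) i → StrictMono (block (blockGraph D) i)
  block-mono D (M , p) = enumerate-mono M (blockSize D M p)

  block-image : ∀ (D : PDesign k t μ) i → image (block (blockGraph D) i) ⊤ ≡ proj₁ i
  block-image D (M , p) = enumerate-image M (blockSize D M p)

  image-block : ∀ (D : PDesign k t μ) {c} (f : Fin (n D) → Fin c) i →
    image (f ∘ block (blockGraph D) i) ⊤ ≡ image f (proj₁ i)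
  image-block D f i = trans (image-∘ f (block (blockGraph D) i) ⊤) (cong (image f) (block-image D i))

  -- Serves to filter the strong copies of `A` in `B` out of the finite list of all maps.
  strong? : ∀ (A B : PDesign k t μ) f → Dec (Strong t (blockGraph A) (blockGraph B) f)
  strong? A B f = map′
    (λ (i , p , r) → record
      { injective = λ {x} {y} → i x y
      ; preserves = p
      ; reflects  = λ j J |J| meets → r j J |J| (λ x x∈J → meets x∈J) })
    (λ s → (λ x y → injective s) , preserves s , λ j J |J| meets → reflects s j J |J| (λ {x} → meets x))
    (injective? ×-dec preserves? ×-dec reflects?)
    where
    G : Hypergraph k (Fin (n A))
    G = blockGraph A

    H : Hypergraph k (Fin (n B))
    H = blockGraph B

    injective? : Dec (∀ x y → f x ≡ f y → x ≡ y)
    injective? = all? λ x → all? λ y → (f x ≟ f y) →-dec (x ≟ y)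

    preserves? : Dec (Preserves G H f)
    preserves? = forall? (listedBlocks A) λ i → exists? (listedBlocks B) λ j → all? λ x → block H j x ≟ f (block G i x)

    reflects? : Dec (∀ j J → ∣ J ∣ ≡ t → (∀ x → x ∈ J → ∃ λ u → block H j x ≡ f u) → ∃ λ i → block H j ≗ f ∘ block G i)
    reflects? = forall? (listedBlocks B) λ j → forall? (listedSubset k) λ J → (∣ J ∣ ℕ.≟ t) →-dec
      ((all? λ x → (x ∈? J) →-dec (any? λ u → block H j x ≟ f u)) →-dec
        (exists? (listedBlocks A) λ i → all? λ x → block H j x ≟ f (block G i x)))

  -- For reflection, the `t` common vertices pull back to a set `S`. The block lies in the
  -- neighbourhood of the image of `S`, so `nbhd` puts it inside the image of `e`, and `blocks`
  -- makes its preimage a block of `A`.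
  embedding-strong : ∀ {A B : PDesign k t μ} (e : Embedding A B) → Strong t (blockGraph A) (blockGraph B) (fun e)
  embedding-strong {A} {B} e = record { injective = inj ; preserves = pres ; reflects = refls }
    where
    inj : Injective _≡_ _≡_ (fun e)
    inj = strictMono-injective (mono e)

    aligned : ∀ i j → proj₁ j ≡ image (fun e) (proj₁ i) → block (blockGraph B) j ≗ fun e ∘ block (blockGraph A) i
    aligned i j p = strictMono-unique (block-mono B j) (λ x y x<y → mono e _ _ (block-mono A i x y x<y))
      (trans (block-image B j) (trans p (sym (image-block A (fun e) i))))

    pres : Preserves (blockGraph A) (blockGraph B) (fun e)
    pres (M , b) = j , aligned (M , b) j refl
      where
      j : Index (blockGraph B)
      j = image (fun e) M , Equivalence.to (blocks e M (blockSize A M b)) b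

    refls : Reflects t (blockGraph A) (blockGraph B) (fun e)
    refls (M , b) J |J| meets = (M₀ , b₀) , aligned (M₀ , b₀) (M , b) (sym M₀-image)
      where
      f : Fin k → Fin (n B)
      f = block (blockGraph B) (M , b)

      f-inj : Injective _≡_ _≡_ f
      f-inj = strictMono-injective (block-mono B (M , b))

      traced : image f J ⊆ image (fun e) ⊤
      traced y∈ with ∈-image⁻ f y∈
      ... | x , x∈J , refl = let u , p = meets x∈J in subst (_∈ image (fun e) ⊤) (sym p) (∈-image⁺ (fun e) ∈⊤)

      trace : ∃ λ S → image (fun e) S ≡ image f J × ∣ S ∣ ≡ ∣ image f J ∣
      trace = pullback inj (image f J) traced

      S : Subset (n A)
      S = proj₁ trace

      |S| : ∣ S ∣ ≡ t
      |S| = trans (proj₂ (proj₂ trace)) (trans (∣image∣ f-inj J) |J|)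

      S⊆M : image (fun e) S ⊆ M
      S⊆M y∈ = ⊆-reflexive (block-image B (M , b)) (image-mono f (λ _ → ∈⊤) (⊆-reflexive (proj₁ (proj₂ trace)) y∈))

      inside-image : M ⊆ image (fun e) ⊤
      inside-image {y} y∈ with Equivalence.to (nbhd e S |S| y) (M , b , S⊆M , y∈)
      ... | x , refl , _ = ∈-image⁺ (fun e) ∈⊤

      whole : ∃ λ M₀ → image (fun e) M₀ ≡ M × ∣ M₀ ∣ ≡ ∣ M ∣
      whole = pullback inj M inside-image

      M₀ : Subset (n A)
      M₀ = proj₁ whole

      M₀-image : image (fun e) M₀ ≡ M
      M₀-image = proj₁ (proj₂ whole)

      b₀ : Block A M₀
      b₀ = Equivalence.from (blocks e M₀ (trans (proj₂ (proj₂ whole)) (blockSize B M b))) (subst (Block B) (sym M₀-image) b)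

  Covered : ∀ (B : PDesign k t μ) {V} → Hypergraph k V → Set
  Covered B {V} H = ∀ i → ∃ λ (ψ : Fin (n B) → V) →
    Strong t (blockGraph B) H ψ × ∃ λ j → block H i ≗ ψ ∘ block (blockGraph B) j

  module Realise (t≤k : t ≤ k) (B : PDesign k t μ) {V : Set} (H : Hypergraph k V) (indices : Listed (Index H))
    {c : ℕ} (h : V → Fin c) (h-injective : Injective _≡_ _≡_ h)
    (cover : Covered B H) where

    IsBlock : Subset c → Set
    IsBlock M = ∃ λ i → image (h ∘ block H i) ⊤ ≡ M

    isBlock? : ∀ M → Dec (IsBlock M)
    isBlock? M = exists? indices λ i → ≡-dec Bool._≟_ (image (h ∘ block H i) ⊤) M

    block-injective : ∀ i → Injective _≡_ _≡_ (h ∘ block H i)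
    block-injective i {x} {y} p with cover i
    ... | ψ , s , j , q = strictMono-injective (block-mono B j)
      (injective s (trans (sym (q x)) (trans (h-injective p) (q y))))

    size-k : ∀ {M} → IsBlock M → ∣ M ∣ ≡ k
    size-k (i , refl) = trans (∣image∣ (block-injective i) ⊤) (∣⊤∣≡n k)

    module _ {ψ : Fin (n B) → V} (s : Strong t (blockGraph B) H ψ) where

      φ : Fin (n B) → Fin c
      φ = h ∘ ψ

      φ-injective : Injective _≡_ _≡_ φ
      φ-injective = injective s ∘ h-injective

      block⇒isBlock : ∀ {M} → Block B M → IsBlock (image φ M)
      block⇒isBlock {M} b with preserves s (M , b)
      ... | i , p = i , trans (image-cong ⊤ (cong h ∘ p)) (image-block B φ (M , b))

      -- The places of the block that carry the image of `S` form a set `J` of size `t`, to which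
      -- strongness of `ψ` applies.
      pullbackBlock : ∀ {M} S → ∣ S ∣ ≡ t → image φ S ⊆ M → IsBlock M → ∃ λ M₀ → Block B M₀ × image φ M₀ ≡ M
      pullbackBlock S |S| S⊆ (i , refl) with pullback (block-injective i) (image φ S) S⊆
      ... | J , J-image , |J| with reflects s i J (trans |J| (trans (∣image∣ φ-injective S) |S|)) meets
        where
        meets : ∀ {x} → x ∈ J → ∃ λ u → block H i x ≡ ψ u
        meets x∈J with ∈-image⁻ φ {S} (⊆-reflexive J-image (∈-image⁺ (h ∘ block H i) x∈J))
        ... | u , _ , p = u , sym (h-injective p)
      ...   | (M₀ , b) , p = M₀ , b , trans (sym (image-block B φ (M₀ , b))) (image-cong ⊤ (sym ∘ cong h ∘ p))

    -- The first block lies in some copy of `B`, hence so does `S`. Each of the other blocks meets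
    -- this copy in the `t` vertices of `S`, so all `suc μ` blocks pull back to `B`, where there are
    -- too many of them.
    few : ∀ (S : Subset c) → ∣ S ∣ ≡ t → ∀ (Ms : Fin (suc μ) → Subset c) → Injective _≡_ _≡_ Ms →
      (∀ y → IsBlock (Ms y) × S ⊆ Ms y) → Empty.⊥
    few S |S| Ms Ms-inj bs with proj₁ (bs zero) | proj₂ (bs zero)
    ... | i , p | S⊆M with cover i
    ...   | ψ , s , j , q with pullback (φ-injective s) S S⊆image
      where
      S⊆image : S ⊆ image (φ s) ⊤
      S⊆image y∈ = image-mono (φ s) (λ _ → ∈⊤) (⊆-reflexive
        (trans (sym p) (trans (image-cong ⊤ (cong h ∘ q)) (image-block B (φ s) j))) (S⊆M y∈))
    ...     | S₀ , S₀-image , |S₀| = partialDesign B S₀ (trans |S₀| |S|) (λ y → proj₁ (pulled y))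
      (λ {y} {z} eq → Ms-inj (trans (sym (proj₂ (proj₂ (pulled y)))) (trans (cong (image (φ s)) eq)
        (proj₂ (proj₂ (pulled z))))))
      λ y → proj₁ (proj₂ (pulled y)) , image-cancel-⊆ (φ-injective s) (λ z∈ →
        ⊆-reflexive (sym (proj₂ (proj₂ (pulled y)))) (proj₂ (bs y) (⊆-reflexive S₀-image z∈)))
      where
      pulled : ∀ y → ∃ λ M₀ → Block B M₀ × image (φ s) M₀ ≡ Ms y
      pulled y = pullbackBlock s S₀ (trans |S₀| |S|) (λ z∈ → proj₂ (bs y) (⊆-reflexive S₀-image z∈)) (proj₁ (bs y))

    design : PDesign k t μ
    design .n = c
    design .isBlock M = ⌊ isBlock? M ⌋
    design .blockSize M b = size-k (toWitness b)
    design .partialDesign S |S| Ms inj bs = few S |S| Ms inj (λ y → toWitness (proj₁ (bs y)) , proj₂ (bs y))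

    embedding : ∀ {ψ} → Strong t (blockGraph B) H ψ → StrictMono (h ∘ ψ) → Embedding B design
    embedding {ψ} s φ-mono = record { fun = φ s ; mono = φ-mono ; blocks = blocks′ ; nbhd = nbhd′ }
      where
      blocks′ : ∀ M → ∣ M ∣ ≡ k → _
      blocks′ M |M| = mk⇔ (λ b → fromWitness (block⇒isBlock s b)) back
        where
        back : Block design (image (φ s) M) → Block B M
        -- As `t ≤ k`, some `t`-subset of `M` is available to pull the block back, and injectivity
        -- of `image` identifies the result with `M`.
        back b with subsetOfSize t M (ℕ.≤-trans t≤k (ℕ.≤-reflexive (sym |M|)))
        ... | S , S⊆ , |S| with pullbackBlock s S |S| (image-mono (φ s) S⊆) (toWitness b)
        ...   | M₀ , b₀ , p = subst (Block B) (image-injective (φ-injective s) p) b₀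

      nbhd′ : ∀ S → ∣ S ∣ ≡ t → ∀ y → _
      nbhd′ S |S| y = mk⇔ there′ back
        where
        there′ : InNbhd design (image (φ s) S) y → ∃ λ x → φ s x ≡ y × InNbhd B S x
        there′ (M , b , S⊆ , y∈) with pullbackBlock s S |S| S⊆ (toWitness b)
        ... | M₀ , b₀ , refl with ∈-image⁻ (φ s) y∈
        ...   | x , x∈ , p = x , p , M₀ , b₀ , image-cancel-⊆ (φ-injective s) S⊆ , x∈

        back : (∃ λ x → φ s x ≡ y × InNbhd B S x) → InNbhd design (image (φ s) S) y
        back (x , refl , M , b , S⊆ , x∈) = image (φ s) M ,
          fromWitness (block⇒isBlock s b) , image-mono (φ s) S⊆ , ∈-image⁺ (φ s) x∈

-- Assembling the Ramsey object from the initial picture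

module Assembly {k t μ : ℕ} (1≤t : 1 ≤ t) (t≤k : t ≤ k) (A B : PDesign k t μ) (r N : ℕ)
  (ramsey : RamseyNumber (suc r) (n A) (n B) N) where

  open Partite 1≤t (blockGraph A) r
  open System
  open Extension

  a b : ℕ
  a = n A
  b = n B

  -- Maps are vectors so that they can be listed. The copies `ε` need not be monotone, for the order
  -- returns only with a monotone `β` at the end; those that `β` collapses are left out to keep the
  -- targets injective.
  GoodPair : Vec (Fin N) b × Vec (Fin b) a → Set
  GoodPair (β , ε) = Strong t (blockGraph A) (blockGraph B) (lookup ε) ×
    (∀ x y → lookup β (lookup ε x) ≡ lookup β (lookup ε y) → x ≡ y)

  goodPair? : ∀ p → Dec (GoodPair p)
  goodPair? (β , ε) = strong? A B (lookup ε) ×-dec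
    all? λ x → all? λ y → (lookup β (lookup ε x) ≟ lookup β (lookup ε y)) →-dec (x ≟ y)

  pairs : Listed (Vec (Fin N) b × Vec (Fin b) a)
  pairs = listed× (listedVec (listedFin N) b) (listedVec (listedFin b) a)

  copyOf : Vec (Fin N) b × Vec (Fin b) a → Fin a → Vec (Fin N) b × Fin b
  copyOf (β , ε) x = β , lookup ε x

  initial-copies : List (Fin a → Vec (Fin N) b × Fin b)
  initial-copies = List.map copyOf (filter goodPair? (elems pairs))

  initial-copy : ∀ {f} → f Mem.∈ initial-copies → ∃ λ p → GoodPair p × f ≡ copyOf p
  initial-copy f∈ with ∈-map⁻ copyOf f∈
  ... | p , p∈ , refl = p , proj₂ (∈-filter⁻ goodPair? {xs = elems pairs} p∈) , refl

  initial : System (Fin N)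
  initial .Vertex             = Vec (Fin N) b × Fin b
  initial .hypergraph         = layers (Vec (Fin N) b) (blockGraph B)
  initial .π (β , x)          = lookup β x
  initial .vertices           = listed× (listedVec (listedFin N) b) (listedFin b)
  initial .indices            = listed× (listedVec (listedFin N) b) (listedBlocks B)
  initial .copies             = initial-copies
  initial .copies-strong f∈ with initial-copy f∈
  ... | (β , ε) , (s , _) , refl = strong-∘ (layer-strong 1≤t β) s

  targets : List (Fin a → Fin N)
  targets = List.map (π initial ∘_) initial-copies

  targets-injective : All (Injective _≡_ _≡_) targets
  targets-injective = All.tabulate λ e∈ → let f , f∈ , p = ∈-map⁻ (π initial ∘_) e∈ in
    subst (Injective _≡_ _≡_) (sym p) (inj f∈)
    where
    inj : ∀ {f} → f Mem.∈ initial-copies → Injective _≡_ _≡_ (π initial ∘ f)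
    inj f∈ {x} {y} p with initial-copy f∈
    ... | _ , (_ , i) , refl = i x y p

  module Final {P : System (Fin N)} (E : Extension initial P) (homogeneous : RamseyOver E targets) where

    -- The projection to [N] is the leading digit, so h is monotone on transversal copies.
    h : Vertex P → Fin (N * size (vertices P))
    h v = combine (π P v) (code (vertices P) v)

    h-injective : Injective _≡_ _≡_ h
    h-injective {u} {v} p = code-injective (vertices P) (Fin.combine-injectiveʳ (π P u) _ (π P v) _ p)

    sheet : Name E → Vec (Fin N) (n B) → Fin (n B) → Vertex P
    sheet l β x = map E l (β , x)

    sheet-strong : ∀ l β → Strong t (blockGraph B) (hypergraph P) (sheet l β)
    sheet-strong l β = strong-∘ (map-strong E l) (layer-strong 1≤t β)

    covered : Covered B (hypergraph P)
    covered i with cover E i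
    ... | l , (β , j) , p = sheet l β , sheet-strong l β , j , p

    open Realise t≤k B (hypergraph P) (indices P) h h-injective covered public

    -- In the copy `l` of the initial picture, the colour of a listed copy of `A` over a target
    -- depends only on its projection. Ramsey's theorem for these colours gives a monotone `β`, and
    -- the sheet of `β` is the copy of `B`.
    find : ∀ (χ : Subset (n design) → Fin (suc r)) → Σ (Embedding B design) λ g → ∃ λ c →
      ∀ (e : Embedding A B) → χ (copy (fun g ∘ fun e)) ≡ c
    find χ = g , proj₁ (proj₂ (proj₂ mono-β)) , constant
      where
      χ′ : (Fin (n A) → Vertex P) → Fin (suc r)
      χ′ f = χ (image (h ∘ f) ⊤)

      χ′-resp : Respects χ′
      χ′-resp p = cong χ (image-cong ⊤ (cong h ∘ p))

      l : Name E
      l = proj₁ (homogeneous (χ′ , χ′-resp))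

      open ColourOver _≟_ initial (λ f → χ′ (map E l ∘ f))

      mono-β : MonoSubset b colourOver
      mono-β = ramsey colourOver

      β : Fin (n B) → Fin N
      β = proj₁ mono-β

      βv : Vec (Fin N) (n B)
      βv = tabulate β

      π-sheet : ∀ x → π P (sheet l βv x) ≡ β x
      π-sheet x = trans (map-π E l (βv , x)) (lookup∘tabulate β x)

      g : Embedding B design
      g = embedding (sheet-strong l βv) λ x y x<y → Fin.combine-monoˡ-< _ _
        (subst₂ Fin._<_ (sym (π-sheet x)) (sym (π-sheet y)) (proj₁ (proj₂ mono-β) x y x<y))

      constant : ∀ (e : Embedding A B) → χ (copy (fun g ∘ fun e)) ≡ proj₁ (proj₂ (proj₂ mono-β))
      constant e = trans (χ′-resp (λ x → cong (sheet l βv) (sym (lookup∘tabulate (fun e) x))))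
          (trans (colourOver-≡ mono-e′ f∈ over) (proj₂ (proj₂ shadow)))
        where
        -- The colour is known at some map pointwise equal to `β ∘ fun e`, not at that map itself.
        shadow : ∃ λ e′ → e′ ≗ β ∘ fun e × colourOver e′ ≡ proj₁ (proj₂ (proj₂ mono-β))
        shadow = proj₂ (proj₂ (proj₂ mono-β)) (fun e) (mono e)

        e′ : Fin (n A) → Fin N
        e′ = proj₁ shadow

        ε : Vec (Fin (n B)) (n A)
        ε = tabulate (fun e)

        f : Fin (n A) → Vertex initial
        f x = βv , lookup ε x

        f-over : π initial ∘ f ≗ β ∘ fun e
        f-over x = trans (lookup∘tabulate β _) (cong β (lookup∘tabulate (fun e) x))

        over : π initial ∘ f ≗ e′
        over x = trans (f-over x) (sym (proj₁ (proj₂ shadow) x))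

        good : GoodPair (βv , ε)
        good = strong-≗ (sym ∘ lookup∘tabulate (fun e)) (embedding-strong e) , λ x y eq →
          strictMono-injective (mono e) (strictMono-injective (proj₁ (proj₂ mono-β))
            (trans (sym (f-over x)) (trans eq (f-over y))))

        f∈ : f Mem.∈ copies initial
        f∈ = ∈-map⁺ copyOf (∈-filter⁺ goodPair? (complete pairs (βv , ε)) good)

        -- The target in the list is `π initial ∘ f`, which is only pointwise equal to `e′`;
        -- homogeneity is transferred from it.
        mono-e′ : MonochromaticOver initial (λ f → χ′ (map E l ∘ f)) e′
        mono-e′ f₁∈ f₂∈ p₁ p₂ = proj₂ (homogeneous (χ′ , χ′-resp)) (∈-map⁺ (π initial ∘_) f∈) f₁∈ f₂∈
          (λ x → trans (p₁ x) (sym (over x))) (λ x → trans (p₂ x) (sym (over x)))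

  ramseyDesign : ∃ λ (C : PDesign k t μ) → ∀ (χ : Subset (n C) → Fin (suc r)) →
    Σ (Embedding B C) λ g → ∃ λ c → ∀ (e : Embedding A B) → χ (copy (fun g ∘ fun e)) ≡ c
  ramseyDesign with partiteConstruction _≟_ initial targets targets-injective
  ... | P , E , homogeneous = Final.design E homogeneous , Final.find E homogeneous

theorem3p1 : ∀ (k t μ : ℕ) → 2 ≤ t → t ≤ k → 1 ≤ μ →
    ∀ (A B : PDesign k t μ) (r : ℕ) → 1 ≤ r →
    ∃ λ (C : PDesign k t μ) →
    ∀ (χ : Subset (n C) → Fin r) →
    Σ (Embedding B C) λ g → ∃ λ (i : Fin r) →
    ∀ (e : Embedding A B) → χ (copy (fun g ∘ fun e)) ≡ i
theorem3p1 k t μ 2≤t t≤k _ A B (suc r) _ with ramseyNumber r (n A) (n B)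
... | N , ramsey = Assembly.ramseyDesign (ℕ.≤-trans (s≤s z≤n) 2≤t) t≤k A B r N ramsey
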